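{- Let $G$ be a finite connected graph, and consider the hat guessing game on $G$ with three colors. The sages lose on $G$ (i.e. they have no winning strategy) if and only if either $G$ is a tree, or $G$ contains exactly one cycle and this cycle has length $n$ with $n\geq 5$ and $n$ not divisible by $3$.
   Context: Hat guessing game: $G$ is a finite simple undirected graph; a sage sits at each vertex. The set of hat colors is $H=\{0,1,2\}$. A hat placement is a function $C\colon V(G)\to H$. Each sage sees exactly the hats of his neighbours in $G$ (not his own) and, without communication, simultaneously guesses the color of his own hat. A (collective, deterministic) strategy is a family of functions $f_v$, one for each vertex $v$, where $f_v$ maps the tuple of colors of the neighbours of $v$ to a color in $H$; sage $v$ guesses correctly for placement $C$ if $f_v(C(u_1),\dots,C(u_k))=C(v)$, where $u_1,\dots,u_k$ are the neighbours of $v$. A strategy is winning if for every hat placement at least one sage guesses correctly. The sages win on $G$ if a winning strategy exists, and lose otherwise. -}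

module Defs where

open import Data.Nat using (ℕ; zero; suc; _≤_)
open import Data.Nat.Divisibility using (_∣_)
open import Data.Fin using (Fin; zero; suc; inject₁; fromℕ)
open import Data.Bool using (Bool; true; false)
open import Data.Product using (Σ; ∃; _×_; _,_)
open import Data.Sum using (_⊎_)
open import Relation.Binary.PropositionalEquality using (_≡_)
open import Relation.Nullary using (¬_)
open import Function.Definitions using (Injective)
open import Function.Bundles using (_⇔_)

record Graph : Set where
  field
    n      : ℕ
    adj    : Fin n → Fin n → Bool
    sym    : ∀ u v → adj u v ≡ adj v u
    irrefl : ∀ v → adj v v ≡ false

open Graph public

Adj : (G : Graph) → Fin (n G) → Fin (n G) → Set
Adj G u v = adj G u v ≡ true

data Walk (G : Graph) : Fin (n G) → Fin (n G) → Set where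
  here : ∀ {u} → Walk G u u
  step : ∀ {u v w} → Adj G u v → Walk G v w → Walk G u w

Connected : Graph → Set
Connected G = ∀ u v → Walk G u v

record Cycle (G : Graph) : Set where
  field
    m       : ℕ
    m≥2     : 2 ≤ m
    vs      : Fin (suc m) → Fin (n G)
    inj     : Injective _≡_ _≡_ vs
    consec  : ∀ (i : Fin m) → Adj G (vs (inject₁ i)) (vs (suc i))
    closing : Adj G (vs (fromℕ m)) (vs zero)

  len : ℕ
  len = suc m

open Cycle public

CycleEdge : {G : Graph} → Cycle G → Fin (n G) → Fin (n G) → Set
CycleEdge c u v =
    (∃ λ (i : Fin (m c)) →
        ((vs c (inject₁ i) ≡ u) × (vs c (suc i) ≡ v))
      ⊎ ((vs c (inject₁ i) ≡ v) × (vs c (suc i) ≡ u)))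
  ⊎ (((vs c (fromℕ (m c)) ≡ u) × (vs c zero ≡ v))
    ⊎ ((vs c (fromℕ (m c)) ≡ v) × (vs c zero ≡ u)))

-- Two cycles are the same cycle (same subgraph) iff they have the same edges.
SameCycle : {G : Graph} → Cycle G → Cycle G → Set
SameCycle {G} c c' = ∀ (u v : Fin (n G)) → CycleEdge c u v ⇔ CycleEdge c' u v

Acyclic : Graph → Set
Acyclic G = ¬ Cycle G

IsTree : Graph → Set
IsTree G = Connected G × Acyclic G

UniqueCycleGood : Graph → Set
UniqueCycleGood G =
  Σ (Cycle G) λ c →
    (∀ (c' : Cycle G) → SameCycle c c') × (5 ≤ len c) × ¬ (3 ∣ len c)

Colour : Set
Colour = Fin 3

Placement : Graph → Set
Placement G = Fin (n G) → Colour

record Strategy (G : Graph) : Set where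
  field
    guess : Fin (n G) → Placement G → Colour
    local : ∀ (v : Fin (n G)) (C C' : Placement G) →
            (∀ u → Adj G v u → C u ≡ C' u) → guess v C ≡ guess v C'

open Strategy public

Winning : {G : Graph} → Strategy G → Set
Winning {G} s = ∀ (C : Placement G) → ∃ λ v → guess s v C ≡ C v

SagesWin : Graph → Set
SagesWin G = Σ (Strategy G) Winning

SagesLose : Graph → Set
SagesLose G = ¬ SagesWin G

{-# OPTIONS --safe #-}

-- Losing. A leaf never helps, so a tree reduces to a single vertex and a unicyclic graph to its
-- cycle. On a cycle let λ(x , y) be the number of colours a for which the vertex coloured x, with
-- neighbours a and y, guesses x. On any path with fixed outer colours there are two placements
-- without correct guess that differ at both ends; comparing with the complement of 2, 3 or 4
-- consecutive vertices, a winning strategy on a cycle of length n ≥ 5 makes every λ a Latin square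
-- with values 0, 1, 2, and a guess is wrong exactly when λ does not increase from one edge to the
-- next. Latin squares of order 3 are affine over ℤ/3 and the λ's telescope around the cycle, so if
-- 3 ∤ n some level ℓ is attained constantly, and that placement beats the strategy.
--
-- Winning. If 3 ∣ n, the same monotone strategy with a twist at one edge leaves no constant level.
-- If there are two cycles, the graph contains a theta graph, two cycles sharing a vertex, or two
-- cycles joined by a path. Along paths the sages guess so that, if all are wrong, one of the two
-- ends learns a bit of its own colour (around a cycle, its root does); this makes all three win.
module Submission where

open import Defs hiding (sym; n; guess; local)
open import Data.Bool.Base using (Bool; true; false; if_then_else_; not; T)
import Data.Bool.Properties as Bool
open import Data.Empty using (⊥; ⊥-elim)
open import Data.Fin.Base using (Fin; zero; suc; toℕ; inject₁; fromℕ; fromℕ<)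
open import Data.Fin.Patterns using (0F; 1F; 2F)
import Data.Fin.Properties as Fin
open import Data.Fin.Properties using (_≟_; all?; any?; ¬∀⟶∃¬)
open import Data.Fin.Relation.Unary.Top using (view; ‵fromℕ; ‵inject₁; view-fromℕ; view-inject₁)
open import Data.List.Base using (List; []; _∷_; _++_; [_]; map; length; reverse; tabulate; lookup; allFin)
open import Data.List.Membership.Propositional using (_∈_; _∉_; find; lose)
open import Data.List.Membership.Propositional.Properties using (∈-∃++; ∈-++⁺ˡ; ∈-++⁺ʳ; ∈-++⁻; ∈-map⁺; ∈-tabulate⁺; ∈-tabulate⁻; ∈-lookup; ∈-allFin)
open import Data.List.Properties using (map-++; unfold-reverse; length-reverse; length-tabulate; ++-assoc; ++-identityʳ; ∷-injective)
open import Data.List.Relation.Binary.Permutation.Propositional using (_↭_; ↭-refl; ↭-sym; ↭-trans; ↭-reflexive; prep; swap; ↭⇒↭ₛ)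
import Data.List.Relation.Binary.Permutation.Propositional.Properties as ↭
import Data.List.Relation.Binary.Permutation.Setoid.Properties as ↭ₛ
open import Data.List.Relation.Unary.All as All using (All; []; _∷_)
import Data.List.Relation.Unary.All.Properties as All
open import Data.List.Relation.Unary.AllPairs using ([]; _∷_)
open import Data.List.Relation.Unary.Any as Any using (Any; here; there)
open import Data.List.Relation.Unary.Unique.Propositional using (Unique)
import Data.List.Relation.Unary.Unique.Propositional.Properties as Unique
open import Data.Nat.Base using (ℕ; zero; suc; _+_; _*_; _∸_; _≤_; _<_; z≤n; s≤s)
open import Data.Nat.Divisibility using (_∣_; divides; ∣m∣n⇒∣m+n)
import Data.Nat.Properties as ℕ
open import Data.Nat.Tactic.RingSolver using (solve-∀)
open import Data.Product using (∃; ∃₂; _×_; _,_; proj₁; proj₂)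
open import Data.Sum using (_⊎_; inj₁; inj₂; [_,_]′)
open import Data.Vec.Base as Vec using (Vec; []; _∷_)
import Data.Vec.Properties as Vec
open import Function.Base using (_∘_; _$_; id; case_of_)
open import Function.Bundles using (_⇔_; mk⇔; Equivalence)
open import Relation.Binary.PropositionalEquality hiding ([_])
open import Relation.Nullary using (¬_; Dec; yes; no)
open import Relation.Nullary.Decidable using (from-yes; ¬?; _×-dec_; _⊎-dec_; _→-dec_; map′; does; dec-true; dec-false)

-- Colours as integers modulo 3

-- The obstacle to Latin squares is the all-ones line. Rows and columns of λ have entries in {0, 1,
-- 2} and sum 3, so each is a permutation or (1, 1, 1); the latter is called `Balanced`. A balanced
-- row forces a balanced column on the same edge, and this a balanced row on the next edge. So
-- balance spreads along the cycle until it governs four consecutive vertices, and there it is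
-- refuted. The complement of these four must still contain a vertex, which is where n ≥ 5 enters.
-- Once all lines are permutations, counting turns monotonicity into an exact criterion: among the
-- colours of the next vertex, the number that make a guess wrong and the number whose level is at
-- most ℓ are both ℓ + 1. Losing is a negation, so the case distinctions on cycles and their edges
-- have to be decided by finite search.

infixl 6 _⊕_

_⊕_ : Colour → Colour → Colour
0F ⊕ y = y
1F ⊕ 0F = 1F
1F ⊕ 1F = 2F
1F ⊕ 2F = 0F
2F ⊕ 0F = 2F
2F ⊕ 1F = 0F
2F ⊕ 2F = 1F

⊖_ : Colour → Colour
⊖ 0F = 0F
⊖ 1F = 2F
⊖ 2F = 1F

_⊛_ : Colour → Colour → Colour
0F ⊛ y = 0F
1F ⊛ y = y
2F ⊛ y = ⊖ y

every? : {P : Colour → Set} → (∀ c → Dec (P c)) → Dec (∀ c → P c)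
every? d = map′ (λ { (p , q , r) → λ { 0F → p ; 1F → q ; 2F → r } }) (λ h → h 0F , h 1F , h 2F)
                (d 0F ×-dec d 1F ×-dec d 2F)

some? : {P : Colour → Set} → (∀ c → Dec (P c)) → Dec (∃ P)
some? d = map′ [ (0F ,_) , [ (1F ,_) , (2F ,_) ]′ ]′
               (λ { (0F , p) → inj₁ p ; (1F , p) → inj₂ (inj₁ p) ; (2F , p) → inj₂ (inj₂ p) })
               (d 0F ⊎-dec d 1F ⊎-dec d 2F)

⊖-zero : ∀ u v → u ⊕ ⊖ v ≡ 0F → u ≡ v
⊖-zero = from-yes (every? λ u → every? λ v → (u ⊕ ⊖ v ≟ 0F) →-dec (u ≟ v))

⊕-three : ∀ c → c ⊕ 1F ⊕ 1F ⊕ 1F ≡ c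
⊕-three = from-yes (every? λ c → c ⊕ 1F ⊕ 1F ⊕ 1F ≟ c)

opaque
  avoid : ∀ (a b : Colour) → ∃ λ c → c ≢ a × c ≢ b
  avoid = from-yes (every? λ a → every? λ b → some? λ c → ¬? (c ≟ a) ×-dec ¬? (c ≟ b))

opaque
  other-two : ∀ (a : Colour) → ∃₂ λ b c → b ≢ a × c ≢ a × b ≢ c
  other-two = from-yes (every? λ a → some? λ b → some? λ c → ¬? (b ≟ a) ×-dec ¬? (c ≟ a) ×-dec ¬? (b ≟ c))

opaque
  pairs-meet : ∀ (a a′ b b′ : Colour) → a ≢ a′ → b ≢ b′ → a ≡ b ⊎ a ≡ b′ ⊎ a′ ≡ b ⊎ a′ ≡ b′
  pairs-meet = from-yes (every? λ a → every? λ a′ → every? λ b → every? λ b′ →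
    ¬? (a ≟ a′) →-dec (¬? (b ≟ b′) →-dec (a ≟ b ⊎-dec a ≟ b′ ⊎-dec a′ ≟ b ⊎-dec a′ ≟ b′)))

-- Paths without correct guess

Rule : Set
Rule = Colour → Colour → Colour

-- Run f k a b c d: colours a, b, …, c, d of the positions 0, 1, …, k, k + 1 such that
-- the guesses f 1, …, f k at the inner positions are all wrong.
data Run (f : ℕ → Rule) : ℕ → Colour → Colour → Colour → Colour → Set where
  []  : ∀ {a b} → Run f 0 a b a b
  _▹_ : ∀ {k a b c d e} → Run f k a b c d → f (suc k) c e ≢ d → Run f (suc k) a b d e

shift : (ℕ → Rule) → ℕ → Rule
shift f i = f (suc i)

_◃_ : ∀ {f k a b c d e} → f 1 a c ≢ b → Run (shift f) k b c d e → Run f (suc k) a b d e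
p ◃ []      = [] ▹ p
p ◃ (r ▹ q) = (p ◃ r) ▹ q

module _ (f : ℕ → Rule) (a : Colour) where

  private
    Ends : ℕ → Colour → Colour → Set
    Ends k c d = ∃ λ b → Run f k a b c d

  -- For each colour `d` induction offers two predecessors, so `d` is lost only if `g` sends both of
  -- them to `d`. Two lost colours would need disjoint pairs among three colours; hence at most one
  -- is lost.
  two-last : ∀ k d → ∃₂ λ c c′ → c ≢ c′ × Ends (suc k) c d × Ends (suc k) c′ d
  two-last zero d with other-two (f 1 a d)
  ... | c , c′ , c≢ , c′≢ , c≢c′ = c , c′ , c≢c′ , (c , [] ▹ (c≢ ∘ sym)) , (c′ , [] ▹ (c′≢ ∘ sym))
  two-last (suc k) e = choose (ok 0F) (ok 1F) (ok 2F)
    where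
    g : Colour → Colour
    g c = f (suc (suc k)) c e

    Blocked : Colour → Set
    Blocked d = ∃₂ λ c c′ → c ≢ c′ × g c ≡ d × g c′ ≡ d

    ok : ∀ d → Ends (suc (suc k)) d e ⊎ Blocked d
    ok d with two-last k d
    ... | c , c′ , c≢c′ , (b , r) , (b′ , r′) with g c ≟ d | g c′ ≟ d
    ...   | no p  | _     = inj₁ (b , r ▹ p)
    ...   | yes _ | no p  = inj₁ (b′ , r′ ▹ p)
    ...   | yes p | yes q = inj₂ (c , c′ , c≢c′ , p , q)

    not-both : ∀ {d d′} → d ≢ d′ → Blocked d → Blocked d′ → ⊥
    not-both d≢d′ (x , x′ , x≢ , p , p′) (y , y′ , y≢ , q , q′) with pairs-meet x x′ y y′ x≢ y≢
    ... | inj₁ refl               = d≢d′ (trans (sym p) q)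
    ... | inj₂ (inj₁ refl)        = d≢d′ (trans (sym p) q′)
    ... | inj₂ (inj₂ (inj₁ refl)) = d≢d′ (trans (sym p′) q)
    ... | inj₂ (inj₂ (inj₂ refl)) = d≢d′ (trans (sym p′) q′)

    choose : Ends (suc (suc k)) 0F e ⊎ Blocked 0F → Ends (suc (suc k)) 1F e ⊎ Blocked 1F →
             Ends (suc (suc k)) 2F e ⊎ Blocked 2F →
             ∃₂ λ c c′ → c ≢ c′ × Ends (suc (suc k)) c e × Ends (suc (suc k)) c′ e
    choose (inj₁ p) (inj₁ q) _        = 0F , 1F , (λ ()) , p , q
    choose (inj₁ p) (inj₂ _) (inj₁ q) = 0F , 2F , (λ ()) , p , q
    choose (inj₂ _) (inj₁ p) (inj₁ q) = 1F , 2F , (λ ()) , p , q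
    choose (inj₁ _) (inj₂ p) (inj₂ q) = ⊥-elim (not-both (λ ()) p q)
    choose (inj₂ p) (inj₁ _) (inj₂ q) = ⊥-elim (not-both (λ ()) p q)
    choose (inj₂ p) (inj₂ q) _        = ⊥-elim (not-both (λ ()) p q)

  -- Two of the three colours d are reached after the same colour; they form the next pair.
  module _ (b₀ : Colour) where

    private
      End : ℕ → Colour → Colour → Set
      End k c d = ∃ λ b → b ≢ b₀ × Run f k a b c d

    pair-attained : ∀ k → ∃₂ λ p q → p ≢ q × (∀ d → End (suc k) p d ⊎ End (suc k) q d)
    pair-attained zero with other-two b₀
    ... | p , q , p≢ , q≢ , p≢q = p , q , p≢q , at
      where
      at : ∀ d → End 1 p d ⊎ End 1 q d
      at d with f 1 a d ≟ p
      ... | no ne    = inj₁ (p , p≢ , [] ▹ ne)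
      ... | yes refl = inj₂ (q , q≢ , [] ▹ p≢q)
    pair-attained (suc k) with pair-attained k
    ... | p , q , p≢q , at = choose (at 0F) (at 1F) (at 2F)
      where
      Goal : Set
      Goal = ∃₂ λ p q → p ≢ q × (∀ d → End (suc (suc k)) p d ⊎ End (suc (suc k)) q d)

      same : ∀ {c d d′} → d ≢ d′ → End (suc k) c d → End (suc k) c d′ → Goal
      same {c} {d} {d′} d≢d′ (b , b≢ , r) (b′ , b′≢ , r′) = d , d′ , d≢d′ , next
        where
        next : ∀ e → End (suc (suc k)) d e ⊎ End (suc (suc k)) d′ e
        next e with f (suc (suc k)) c e ≟ d
        ... | no ne = inj₁ (b , b≢ , r ▹ ne)
        ... | yes p = inj₂ (b′ , b′≢ , r′ ▹ (λ q → d≢d′ (trans (sym p) q)))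

      choose : (End (suc k) p 0F ⊎ End (suc k) q 0F) → (End (suc k) p 1F ⊎ End (suc k) q 1F) →
               (End (suc k) p 2F ⊎ End (suc k) q 2F) → Goal
      choose (inj₁ x) (inj₁ y) _        = same {d = 0F} {1F} (λ ()) x y
      choose (inj₁ x) (inj₂ _) (inj₁ y) = same {d = 0F} {2F} (λ ()) x y
      choose (inj₁ _) (inj₂ x) (inj₂ y) = same {d = 1F} {2F} (λ ()) x y
      choose (inj₂ _) (inj₁ x) (inj₁ y) = same {d = 1F} {2F} (λ ()) x y
      choose (inj₂ x) (inj₁ _) (inj₂ y) = same {d = 0F} {2F} (λ ()) x y
      choose (inj₂ x) (inj₂ y) _        = same {d = 0F} {1F} (λ ()) x y

  opaque
    -- If the two runs of `two-last` begin with the same colour `b`, then `pair-attained` supplies a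
    -- run that avoids `b`, and its last inner colour differs from at least one of the two.
    crossing-runs : ∀ k d → ∃₂ λ b c → ∃₂ λ b′ c′ →
      b ≢ b′ × c ≢ c′ × Run f (suc k) a b c d × Run f (suc k) a b′ c′ d
    crossing-runs k d with two-last k d
    ... | c , c′ , c≢c′ , (b , r) , (b′ , r′) with b ≟ b′
    ...   | no b≢b′  = b , c , b′ , c′ , b≢b′ , c≢c′ , r , r′
    ...   | yes refl with other (proj₂ (proj₂ (proj₂ (pair-attained b k))) d)
      where
      other : ∀ {p q} → (∃ λ b₁ → b₁ ≢ b × Run f (suc k) a b₁ p d) ⊎ (∃ λ b₁ → b₁ ≢ b × Run f (suc k) a b₁ q d) →
              ∃₂ λ b₁ c₁ → b₁ ≢ b × Run f (suc k) a b₁ c₁ d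
      other {p} {q} = [ (λ { (b₁ , ne , s) → b₁ , p , ne , s }) , (λ { (b₁ , ne , s) → b₁ , q , ne , s }) ]′
    ...     | b₁ , c₁ , b₁≢b , s with c₁ ≟ c
    ...       | no c₁≢c  = b₁ , c₁ , b , c , b₁≢b , c₁≢c , s , r
    ...       | yes refl = b₁ , c₁ , b , c′ , b₁≢b , c≢c′ , s , r′

-- Counting on three colours

tab : Colour → Colour → Colour → Colour → Colour
tab u v w 0F = u
tab u v w 1F = v
tab u v w 2F = w

-- `count` and `sum-toℕ` evaluate `g` only at the three colours, so a fact checked for every
-- `tab u v w` carries over to every `g` without extensionality.
tab-η : ∀ (g : Colour → Colour) b → tab (g 0F) (g 1F) (g 2F) b ≡ g b
tab-η g 0F = refl
tab-η g 1F = refl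
tab-η g 2F = refl

sum₃ : (Colour → ℕ) → ℕ
sum₃ g = g 0F + (g 1F + g 2F)

count : (Colour → Colour) → Colour → ℕ
count g x = sum₃ λ b → if does (g b ≟ x) then 1 else 0

opaque
  count-total : ∀ g → sum₃ (count g) ≡ 3
  count-total g = lemma (g 0F) (g 1F) (g 2F)
    where
    lemma : ∀ u v w → sum₃ (count (tab u v w)) ≡ 3
    lemma = from-yes (every? λ u → every? λ v → every? λ w → sum₃ (count (tab u v w)) ℕ.≟ 3)

opaque
  count≥1 : ∀ g x b → g b ≡ x → 1 ≤ count g x
  count≥1 g x b p = lemma (g 0F) (g 1F) (g 2F) x b (trans (tab-η g b) p)
    where
    lemma : ∀ u v w x b → tab u v w b ≡ x → 1 ≤ count (tab u v w) x
    lemma = from-yes (every? λ u → every? λ v → every? λ w → every? λ x → every? λ b →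
      (tab u v w b ≟ x) →-dec (1 ℕ.≤? count (tab u v w) x))

opaque
  count≥2 : ∀ g x b b′ → b ≢ b′ → g b ≡ x → g b′ ≡ x → 2 ≤ count g x
  count≥2 g x b b′ b≢b′ p q =
    lemma (g 0F) (g 1F) (g 2F) x b b′ b≢b′ (trans (tab-η g b) p) (trans (tab-η g b′) q)
    where
    lemma : ∀ u v w x b b′ → b ≢ b′ → tab u v w b ≡ x → tab u v w b′ ≡ x → 2 ≤ count (tab u v w) x
    lemma = from-yes (every? λ u → every? λ v → every? λ w → every? λ x → every? λ b → every? λ b′ →
      ¬? (b ≟ b′) →-dec ((tab u v w b ≟ x) →-dec ((tab u v w b′ ≟ x) →-dec (2 ℕ.≤? count (tab u v w) x))))

opaque
  count-unique : ∀ g x → count g x ≡ 1 → ∃ λ b → g b ≡ x × (∀ b′ → g b′ ≡ x → b′ ≡ b)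
  count-unique g x p = let (b , q , u) = lemma (g 0F) (g 1F) (g 2F) x p in
    b , trans (sym (tab-η g b)) q , λ b′ r → u b′ (trans (tab-η g b′) r)
    where
    lemma : ∀ u v w x → count (tab u v w) x ≡ 1 →
            ∃ λ b → tab u v w b ≡ x × (∀ b′ → tab u v w b′ ≡ x → b′ ≡ b)
    lemma = from-yes (every? λ u → every? λ v → every? λ w → every? λ x →
      (count (tab u v w) x ℕ.≟ 1) →-dec
      (some? λ b → (tab u v w b ≟ x) ×-dec (every? λ b′ → (tab u v w b′ ≟ x) →-dec (b′ ≟ b))))

count≡3 : ∀ g x → (∀ b → g b ≡ x) → count g x ≡ 3
count≡3 g x p with g 0F | p 0F | g 1F | p 1F | g 2F | p 2F
count≡3 g 0F p | _ | refl | _ | refl | _ | refl = refl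
count≡3 g 1F p | _ | refl | _ | refl | _ | refl = refl
count≡3 g 2F p | _ | refl | _ | refl | _ | refl = refl

-- The two pairs differ in both coordinates, as crossing runs do, so two hits by the same function
-- occur at distinct arguments.
covered : ∀ g h x y {a a′ b b′} → b ≢ b′ → a ≢ a′ →
  g b ≡ x ⊎ h a ≡ y → g b′ ≡ x ⊎ h a′ ≡ y → 2 ≤ count g x + count h y
covered g h x y {b = b} {b′} b≢ a≢ (inj₁ p) (inj₁ q) = ℕ.m≤n⇒m≤n+o (count h y) (count≥2 g x b b′ b≢ p q)
covered g h x y {a} {b′ = b′} b≢ a≢ (inj₂ p) (inj₁ q) = ℕ.+-mono-≤ (count≥1 g x b′ q) (count≥1 h y a p)
covered g h x y {a′ = a′} {b} b≢ a≢ (inj₁ p) (inj₂ q) = ℕ.+-mono-≤ (count≥1 g x b p) (count≥1 h y a′ q)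
covered g h x y {a} {a′} b≢ a≢ (inj₂ p) (inj₂ q) = ℕ.m≤n⇒m≤o+n (count g x) (count≥2 h y a a′ a≢ p q)

-- Winning strategies on a cycle

-- Indices run through ℕ with period `n`, so that `shift` rotates the cycle. A run with `n` inner
-- positions that repeats its two initial colours is a placement without correct guess.
record Winner (n : ℕ) (f : ℕ → Rule) : Set where
  field
    periodic : ∀ j → f (j + n) ≡ f j
    unbeaten : ∀ a b → ¬ Run f n a b a b

open Winner

shift-winner : ∀ {n f} → Winner (suc n) f → Winner (suc n) (shift f)
shift-winner W = record
  { periodic = λ j → periodic W (suc j)
  ; unbeaten = λ { a b (r ▹ q) → unbeaten W _ a (subst (λ g → g _ b ≢ a) (periodic W 1) q ◃ r) } }

sum₃-cong : ∀ {g h : Colour → ℕ} → (∀ c → g c ≡ h c) → sum₃ g ≡ sum₃ h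
sum₃-cong p = cong₂ _+_ (p 0F) (cong₂ _+_ (p 1F) (p 2F))

opaque
  sum₃-+ : ∀ (g h : Colour → ℕ) → sum₃ (λ c → g c + h c) ≡ sum₃ g + sum₃ h
  sum₃-+ g h = lemma (g 0F) (g 1F) (g 2F) (h 0F) (h 1F) (h 2F)
    where
    lemma : ∀ x y z u v w → (x + u) + ((y + v) + (z + w)) ≡ (x + (y + z)) + (u + (v + w))
    lemma = solve-∀

sum₃-tight : ∀ (g : Colour → ℕ) k → (∀ c → k ≤ g c) → sum₃ g ≡ k + (k + k) → ∀ c → g c ≡ k
sum₃-tight g k lo eq c = ℕ.≤-antisym (hi c) (lo c)
  where
  hi : ∀ c → g c ≤ k
  hi 0F = ℕ.+-cancelʳ-≤ (k + k) (g 0F) k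
    (ℕ.≤-trans (ℕ.+-monoʳ-≤ (g 0F) (ℕ.+-mono-≤ (lo 1F) (lo 2F))) (ℕ.≤-reflexive eq))
  hi 1F = ℕ.+-cancelʳ-≤ (k + k) (g 1F) k
    (ℕ.≤-trans (ℕ.+-monoʳ-≤ (g 1F) (ℕ.+-mono-≤ (lo 0F) (lo 2F))) (ℕ.≤-reflexive (trans (exchange (g 0F) (g 1F) (g 2F)) eq)))
    where
    exchange : ∀ x y z → y + (x + z) ≡ x + (y + z)
    exchange = solve-∀
  hi 2F = ℕ.+-cancelʳ-≤ (k + k) (g 2F) k
    (ℕ.≤-trans (ℕ.+-monoʳ-≤ (g 2F) (ℕ.+-mono-≤ (lo 0F) (lo 1F))) (ℕ.≤-reflexive (trans (rotate (g 0F) (g 1F) (g 2F)) eq)))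
    where
    rotate : ∀ x y z → z + (x + y) ≡ x + (y + z)
    rotate = solve-∀

-- Nine cells of at least 2 whose total is 9 + 9 leave no slack. The sums of `B` are known by rows
-- and those of `A` by columns, hence the exchange of summations.
double-tight : ∀ (A B : Colour → Colour → ℕ) → (∀ p q → 2 ≤ B p q + A p q) →
  (∀ p → sum₃ (B p) ≡ 3) → (∀ q → sum₃ (λ p → A p q) ≡ 3) → ∀ p q → B p q + A p q ≡ 2
double-tight A B lo B≡3 A≡3 p =
  sum₃-tight (λ q → B p q + A p q) 2 (lo p)
    (sum₃-tight (λ p → sum₃ λ q → B p q + A p q) 6
      (λ p → ℕ.+-mono-≤ (lo p 0F) (ℕ.+-mono-≤ (lo p 1F) (lo p 2F))) total p)
  where
  swapped : sum₃ (λ p → sum₃ (A p)) ≡ sum₃ (λ q → sum₃ λ p → A p q)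
  swapped = sym (trans (sum₃-+ (A 0F) (λ q → A 1F q + A 2F q)) (cong (sum₃ (A 0F) +_) (sum₃-+ (A 1F) (A 2F))))

  total : sum₃ (λ p → sum₃ λ q → B p q + A p q) ≡ 18
  total = trans (cong₂ _+_ (sum₃-+ (B 0F) (A 0F)) (cong₂ _+_ (sum₃-+ (B 1F) (A 1F)) (sum₃-+ (B 2F) (A 2F))))
    (trans (sum₃-+ (λ p → sum₃ (B p)) (λ p → sum₃ (A p)))
      (cong₂ _+_ (sum₃-cong B≡3) (trans swapped (sum₃-cong A≡3))))

-- This is λ as a colour. Cutting 3 down to 2 does no harm, since `edge` bounds the count by 2 under
-- a winning strategy.
level : Rule → Colour → Colour → Colour
level h x y = clamp (count (λ a → h a y) x)
  where
  clamp : ℕ → Colour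
  clamp 0 = 0F
  clamp 1 = 1F
  clamp _ = 2F

toℕ-level : ∀ h x y → count (λ a → h a y) x ≤ 2 → toℕ (level h x y) ≡ count (λ a → h a y) x
toℕ-level h x y le with count (λ a → h a y) x
... | 0 = refl
... | 1 = refl
... | 2 = refl
toℕ-level h x y (s≤s (s≤s ())) | suc (suc (suc _))

sum-toℕ : (Colour → Colour) → ℕ
sum-toℕ g = sum₃ (toℕ ∘ g)

Balanced : (Colour → Colour) → Set
Balanced g = ∀ c → g c ≡ 1F

opaque
  ones : ∀ g → sum-toℕ g ≡ 3 → (∀ c → g c ≢ 2F) → Balanced g
  ones g p q c = trans (sym (tab-η g c)) (lemma (g 0F) (g 1F) (g 2F) p (q 0F) (q 1F) (q 2F) c)
    where
    lemma : ∀ u v w → sum-toℕ (tab u v w) ≡ 3 → u ≢ 2F → v ≢ 2F → w ≢ 2F → Balanced (tab u v w)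
    lemma = from-yes (every? λ u → every? λ v → every? λ w → (sum-toℕ (tab u v w) ℕ.≟ 3) →-dec
      (¬? (u ≟ 2F) →-dec (¬? (v ≟ 2F) →-dec (¬? (w ≟ 2F) →-dec every? λ c → tab u v w c ≟ 1F))))

opaque
  has-one : ∀ g → sum-toℕ g ≡ 3 → ∃ λ c → g c ≡ 1F
  has-one g p = let (c , q) = lemma (g 0F) (g 1F) (g 2F) p in c , trans (sym (tab-η g c)) q
    where
    lemma : ∀ u v w → sum-toℕ (tab u v w) ≡ 3 → ∃ λ c → tab u v w c ≡ 1F
    lemma = from-yes (every? λ u → every? λ v → every? λ w →
      (sum-toℕ (tab u v w) ℕ.≟ 3) →-dec (some? λ c → tab u v w c ≟ 1F))

opaque
  third-one : ∀ g c c′ → c ≢ c′ → sum-toℕ g ≡ 3 → g c ≡ 1F → g c′ ≡ 1F → Balanced g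
  third-one g c c′ ne p q r d = trans (sym (tab-η g d))
    (lemma (g 0F) (g 1F) (g 2F) c c′ ne p (trans (tab-η g c) q) (trans (tab-η g c′) r) d)
    where
    lemma : ∀ u v w c c′ → c ≢ c′ → sum-toℕ (tab u v w) ≡ 3 → tab u v w c ≡ 1F → tab u v w c′ ≡ 1F →
            Balanced (tab u v w)
    lemma = from-yes (every? λ u → every? λ v → every? λ w → every? λ c → every? λ c′ → ¬? (c ≟ c′) →-dec
      ((sum-toℕ (tab u v w) ℕ.≟ 3) →-dec ((tab u v w c ≟ 1F) →-dec ((tab u v w c′ ≟ 1F) →-dec
      every? λ d → tab u v w d ≟ 1F))))

opaque
  permutation : ∀ g → sum-toℕ g ≡ 3 → ¬ Balanced g → ∀ c c′ → g c ≡ g c′ → c ≡ c′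
  permutation g p ¬bal c c′ q = lemma (g 0F) (g 1F) (g 2F) p (λ bal → ¬bal λ d → trans (sym (tab-η g d)) (bal d)) c c′
    (trans (tab-η g c) (trans q (sym (tab-η g c′))))
    where
    lemma : ∀ u v w → sum-toℕ (tab u v w) ≡ 3 → ¬ Balanced (tab u v w) →
            ∀ c c′ → tab u v w c ≡ tab u v w c′ → c ≡ c′
    lemma = from-yes (every? λ u → every? λ v → every? λ w → (sum-toℕ (tab u v w) ℕ.≟ 3) →-dec
      (¬? (every? λ c → tab u v w c ≟ 1F) →-dec (every? λ c → every? λ c′ → (tab u v w c ≟ tab u v w c′) →-dec (c ≟ c′))))

affine : Colour → Colour → Colour → Colour
affine u v y = u ⊕ ((v ⊕ ⊖ u) ⊛ y)

opaque
  -- Three points have six permutations, and there are six maps y ↦ u + s y with s nonzero modulo 3.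
  injective⇒affine : ∀ (g : Colour → Colour) → (∀ c c′ → g c ≡ g c′ → c ≡ c′) → ∀ y → g y ≡ affine (g 0F) (g 1F) y
  injective⇒affine g inj y = trans (sym (tab-η g y)) (lemma (g 0F) (g 1F) (g 2F) (apart λ ()) (apart λ ()) (apart λ ()) y)
    where
    apart : ∀ {c c′} → c ≢ c′ → g c ≢ g c′
    apart ne p = ne (inj _ _ p)
    lemma : ∀ u v w → u ≢ v → u ≢ w → v ≢ w → ∀ y → tab u v w y ≡ affine u v y
    lemma = from-yes (every? λ u → every? λ v → every? λ w → ¬? (u ≟ v) →-dec (¬? (u ≟ w) →-dec (¬? (v ≟ w) →-dec
      every? λ y → tab u v w y ≟ affine u v y)))

-- A Latin square of order 3 is affine: rows and columns are affine, and a mixed term x y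
-- would make the slope of some row vanish.
opaque
  latin⇒affine : ∀ (M : Colour → Colour → Colour) →
    (∀ x y y′ → M x y ≡ M x y′ → y ≡ y′) → (∀ y x x′ → M x y ≡ M x′ y → x ≡ x′) →
    ∀ x y → M x y ≡ M 0F 0F ⊕ ((M 1F 0F ⊕ ⊖ M 0F 0F) ⊛ x) ⊕ ((M 0F 1F ⊕ ⊖ M 0F 0F) ⊛ y)
  latin⇒affine M rows cols x y = trans (biaffine x y)
    (lemma (M 0F 0F) (M 1F 0F) (M 0F 1F) (M 1F 1F) slope x y)
    where
    F : (u v u′ v′ x y : Colour) → Colour
    F u v u′ v′ x y = affine (affine u v x) (affine u′ v′ x) y

    biaffine : ∀ x y → M x y ≡ F (M 0F 0F) (M 1F 0F) (M 0F 1F) (M 1F 1F) x y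
    biaffine x y = trans (injective⇒affine (M x) (rows x) y)
      (cong₂ (λ u v → affine u v y) (injective⇒affine (λ x → M x 0F) (cols 0F) x)
                                    (injective⇒affine (λ x → M x 1F) (cols 1F) x))

    slope : ∀ x → F (M 0F 0F) (M 1F 0F) (M 0F 1F) (M 1F 1F) x 0F ≢ F (M 0F 0F) (M 1F 0F) (M 0F 1F) (M 1F 1F) x 1F
    slope x p = case rows x 0F 1F (trans (biaffine x 0F) (trans p (sym (biaffine x 1F)))) of λ ()

    lemma : ∀ u v u′ v′ → (∀ x → F u v u′ v′ x 0F ≢ F u v u′ v′ x 1F) →
            ∀ x y → F u v u′ v′ x y ≡ u ⊕ ((v ⊕ ⊖ u) ⊛ x) ⊕ ((u′ ⊕ ⊖ u) ⊛ y)
    lemma = from-yes (every? λ u → every? λ v → every? λ u′ → every? λ v′ →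
      (every? λ x → ¬? (F u v u′ v′ x 0F ≟ F u v u′ v′ x 1F)) →-dec
      (every? λ x → every? λ y → F u v u′ v′ x y ≟ u ⊕ ((v ⊕ ⊖ u) ⊛ x) ⊕ ((u′ ⊕ ⊖ u) ⊛ y)))

opaque
  -- The guess `g` is wrong for exactly ℓ + 1 colours `b`, and all of these satisfy r b ≤ ℓ. As `r`
  -- is a permutation, only ℓ + 1 colours do, so the two sets coincide.
  tight-wrong : ∀ (r g : Colour → Colour) ℓ x → sum-toℕ r ≡ 3 → ¬ Balanced r → count g x + toℕ ℓ ≡ 2 →
    (∀ b → g b ≢ x → toℕ (r b) ≤ toℕ ℓ) → ∀ b → r b ≡ ℓ → g b ≢ x
  tight-wrong r g ℓ x s ¬bal cnt mono b p q =
    lemma (r 0F) (r 1F) (r 2F) s (λ bal → ¬bal λ d → trans (sym (tab-η r d)) (bal d))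
      (g 0F) (g 1F) (g 2F) x ℓ cnt
      (λ b ne → subst (λ z → toℕ z ≤ toℕ ℓ) (sym (tab-η r b)) (mono b λ q → ne (trans (tab-η g b) q)))
      b (trans (tab-η r b) p) (trans (tab-η g b) q)
    where
    lemma : ∀ u v w → sum-toℕ (tab u v w) ≡ 3 → ¬ Balanced (tab u v w) →
            ∀ u′ v′ w′ x ℓ → count (tab u′ v′ w′) x + toℕ ℓ ≡ 2 →
            (∀ b → tab u′ v′ w′ b ≢ x → toℕ (tab u v w b) ≤ toℕ ℓ) →
            ∀ b → tab u v w b ≡ ℓ → tab u′ v′ w′ b ≢ x
    lemma = from-yes (every? λ u → every? λ v → every? λ w → (sum-toℕ (tab u v w) ℕ.≟ 3) →-dec
      (¬? (every? λ c → tab u v w c ≟ 1F) →-dec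
      (every? λ u′ → every? λ v′ → every? λ w′ → every? λ x → every? λ ℓ →
        (count (tab u′ v′ w′) x + toℕ ℓ ℕ.≟ 2) →-dec
        ((every? λ b → ¬? (tab u′ v′ w′ b ≟ x) →-dec (toℕ (tab u v w b) ℕ.≤? toℕ ℓ)) →-dec
        (every? λ b → (tab u v w b ≟ ℓ) →-dec ¬? (tab u′ v′ w′ b ≟ x))))))

right-or-right : ∀ {a b x y : Colour} → ¬ (a ≢ x × b ≢ y) → a ≡ x ⊎ b ≡ y
right-or-right {a} {b} {x} {y} ne with a ≟ x | b ≟ y
... | yes p | _     = inj₁ p
... | no _  | yes q = inj₂ q
... | no p  | no q  = ⊥-elim (ne (p , q))

-- Deleting at most one cell from each row and each column of a 3 × 3 board
-- leaves more than two cells in general position.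
opaque
  two-cells : ∀ (u v : Colour → Colour) {i₀ i₁ j₀ j₁} → i₀ ≢ i₁ → j₀ ≢ j₁ →
    (∀ i j → u j ≢ i → v i ≢ j → i ≡ i₀ × j ≡ j₀ ⊎ i ≡ i₁ × j ≡ j₁) → ⊥
  two-cells u v {i₀} {i₁} {j₀} {j₁} i₀≢i₁ j₀≢j₁ free
    with avoid i₀ i₁ | avoid j₀ j₁
  ... | i₂ , i₂≢i₀ , i₂≢i₁ | j₂ , j₂≢j₀ , j₂≢j₁ = [ case-u , case-v ]′ (row j₂)
    where
    row : ∀ j → u j ≡ i₂ ⊎ v i₂ ≡ j
    row j = right-or-right λ { (x , y) → [ i₂≢i₀ ∘ proj₁ , i₂≢i₁ ∘ proj₁ ]′ (free i₂ j x y) }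

    column : ∀ i → u j₂ ≡ i ⊎ v i ≡ j₂
    column i = right-or-right λ { (x , y) → [ j₂≢j₀ ∘ proj₂ , j₂≢j₁ ∘ proj₂ ]′ (free i j₂ x y) }

    case-u : u j₂ ≡ i₂ → ⊥
    case-u uj₂ with avoid (v i₂) j₂
    ... | j , j≢vi₂ , j≢j₂ = finish (at i₀ i₂≢i₀) (at i₁ i₂≢i₁)
      where
      at : ∀ i → i₂ ≢ i → i ≡ i₀ × j ≡ j₀ ⊎ i ≡ i₁ × j ≡ j₁
      at i i₂≢i = free i j
        (λ p → [ (λ q → i₂≢i (trans (sym q) p)) , (λ q → j≢vi₂ (sym q)) ]′ (row j))
        (λ p → [ (λ q → i₂≢i (trans (sym uj₂) q)) , (λ q → j≢j₂ (trans (sym p) q)) ]′ (column i))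

      finish : i₀ ≡ i₀ × j ≡ j₀ ⊎ i₀ ≡ i₁ × j ≡ j₁ → i₁ ≡ i₀ × j ≡ j₀ ⊎ i₁ ≡ i₁ × j ≡ j₁ → ⊥
      finish (inj₁ (_ , p)) (inj₂ (_ , q)) = j₀≢j₁ (trans (sym p) q)
      finish (inj₂ (p , _)) _ = i₀≢i₁ p
      finish _ (inj₁ (p , _)) = i₀≢i₁ (sym p)

    case-v : v i₂ ≡ j₂ → ⊥
    case-v vi₂ with avoid (u j₂) i₂
    ... | i , i≢uj₂ , i≢i₂ = finish (at j₀ j₂≢j₀) (at j₁ j₂≢j₁)
      where
      at : ∀ j → j₂ ≢ j → i ≡ i₀ × j ≡ j₀ ⊎ i ≡ i₁ × j ≡ j₁
      at j j₂≢j = free i j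
        (λ p → [ (λ q → i≢i₂ (trans (sym p) q)) , (λ q → j₂≢j (trans (sym vi₂) q)) ]′ (row j))
        (λ p → [ (λ q → i≢uj₂ (sym q)) , (λ q → j₂≢j (trans (sym q) p)) ]′ (column i))

      finish : i ≡ i₀ × j₀ ≡ j₀ ⊎ i ≡ i₁ × j₀ ≡ j₁ → i ≡ i₀ × j₁ ≡ j₀ ⊎ i ≡ i₁ × j₁ ≡ j₁ → ⊥
      finish (inj₁ (p , _)) (inj₂ (q , _)) = i₀≢i₁ (trans (sym p) q)
      finish (inj₂ (_ , p)) _ = j₀≢j₁ p
      finish _ (inj₁ (_ , p)) = j₀≢j₁ (sym p)

-- Levels under a winning strategy

module Edges {m} {f : ℕ → Rule} (W : Winner (5 + m) f) where

  f₀⁻ : ∀ {a x p} → f 0 a x ≢ p → f (5 + m) a x ≢ p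
  f₀⁻ = subst (λ g → g _ _ ≢ _) (sym (periodic W 0))

  opaque
    -- With vertices 0 and 1 coloured `p` and `q`, both crossing runs on the remaining path must be
    -- caught by one of these two vertices. This gives at least 2, and the totals force equality.
    edge : ∀ p q → count (f 1 p) q + count (λ a → f 0 a q) p ≡ 2
    edge = double-tight _ (λ p q → count (f 1 p) q) lower (λ p → count-total (f 1 p)) (λ q → count-total λ a → f 0 a q)
      where
      kill : ∀ {p q a b} → Run (shift f) (3 + m) q b a p → f 1 p b ≡ q ⊎ f 0 a q ≡ p
      kill r = right-or-right λ { (u , v) → unbeaten W _ _ ((u ◃ r) ▹ f₀⁻ v) }

      lower : ∀ p q → 2 ≤ count (f 1 p) q + count (λ a → f 0 a q) p
      lower p q with crossing-runs (shift f) q (2 + m) p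
      ... | b , a , b′ , a′ , b≢ , a≢ , r , r′ = covered (f 1 p) (λ a → f 0 a q) q p b≢ a≢ (kill r) (kill r′)

  opaque
    level≡ : ∀ p q → toℕ (level (f 0) p q) ≡ count (λ a → f 0 a q) p
    level≡ p q = toℕ-level (f 0) p q (ℕ.≤-trans (ℕ.m≤n+m _ (count (f 1 p) q)) (ℕ.≤-reflexive (edge p q)))

  opaque
    colevel : ∀ p q → count (f 1 p) q + toℕ (level (f 0) p q) ≡ 2
    colevel p q = trans (cong (count (f 1 p) q +_) (level≡ p q)) (edge p q)

  opaque
    column-sum : ∀ q → sum-toℕ (λ p → level (f 0) p q) ≡ 3
    column-sum q = trans (sum₃-cong λ p → level≡ p q) (count-total λ a → f 0 a q)

  opaque
    row-sum : ∀ p → sum-toℕ (level (f 0) p) ≡ 3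
    row-sum p = ℕ.+-cancelˡ-≡ 3 _ _ (trans (cong (_+ sum-toℕ (level (f 0) p)) (sym (count-total (f 1 p))))
      (trans (sym (sum₃-+ (count (f 1 p)) (toℕ ∘ level (f 0) p))) (sum₃-cong (colevel p))))

  opaque
    balanced-column : ∀ p → Balanced (level (f 0) p) → ∃ λ q → Balanced λ p′ → level (f 0) p′ q
    balanced-column p bal with other-two p
    ... | p′ , _ , p′≢p , _ with has-one (level (f 0) p′) (row-sum p′)
    ... | q , one = q , third-one (λ p → level (f 0) p q) p′ p p′≢p (column-sum q) one (bal q)

module Windows {m} {f : ℕ → Rule} (W : Winner (5 + m) f) where

  open Edges W
  module E₁ = Edges (shift-winner W)

  opaque
    -- Since vertex 1 is wrong, vertices 0 and 2 have to catch the crossing runs on the rest, so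
    -- their counts sum to at least 2. The count of vertex 2 cancels against `colevel` on the next
    -- edge.
    level-mono : ∀ {p x q} → f 1 p q ≢ x → toℕ (level (f 1) x q) ≤ toℕ (level (f 0) p x)
    level-mono {p} {x} {q} w with crossing-runs (shift (shift f)) q (1 + m) p
    ... | b , a , b′ , a′ , b≢ , a≢ , r , r′ =
      ℕ.+-cancelˡ-≤ (count (f 2 x) q) _ _ (ℕ.≤-trans (ℕ.≤-reflexive (E₁.colevel x q))
        (ℕ.≤-trans (covered (f 2 x) (λ a → f 0 a x) q p b≢ a≢ (kill r) (kill r′))
                   (ℕ.+-monoʳ-≤ (count (f 2 x) q) (ℕ.≤-reflexive (sym (level≡ p x))))))
      where
      kill : ∀ {a b} → Run (shift (shift f)) (2 + m) q b a p → f 2 x b ≡ q ⊎ f 0 a x ≡ p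
      kill r = right-or-right λ { (u , v) → unbeaten W _ _ ((w ◃ (u ◃ r)) ▹ f₀⁻ v) }

  opaque
    -- A level 2 in the row would exceed every level 1 of the column. By `level-mono` the vertex
    -- would then be right for all three colours `a`, making that level's count 3.
    balanced-through : ∀ x → Balanced (λ p → level (f 0) p x) → Balanced (level (f 1) x)
    balanced-through x bal = ones (level (f 1) x) (E₁.row-sum x) no-2
      where
      no-2 : ∀ b → level (f 1) x b ≢ 2F
      no-2 b eq = 2≢3 (trans (trans (sym (cong toℕ eq)) (E₁.level≡ x b)) (count≡3 (λ a → f 1 a b) x all-right))
        where
        2≢3 : 2 ≢ 3
        2≢3 ()
        all-right : ∀ a → f 1 a b ≡ x
        all-right a with f 1 a b ≟ x
        ... | yes p = p
        ... | no ne = case subst₂ _≤_ (cong toℕ eq) (cong toℕ (bal a)) (level-mono ne) of λ { (s≤s ()) }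

  -- The possible colour pairs (i , j) of vertices 1 and 2 number at least three, but each
  -- of them must be caught by vertex 0 or vertex 3 in both crossing runs, which only two can be.
  opaque
    no-balanced-pair : ∀ p q →
      Balanced (level (f 0) p) → (∀ a → count (f 0 a) p ≡ 1) →
      (∀ b → count (λ j → f 3 j b) q ≡ 1) → (∀ j → count (f 3 j) q ≡ 1) → ⊥
    no-balanced-pair p q bal₀ right₀ left₃ right₃ with crossing-runs (shift (shift (shift f))) q m p
    ... | b , a , b′ , a′ , b≢ , a≢ , r , r′
      with count-unique (f 0 a) p (right₀ a) | count-unique (f 0 a′) p (right₀ a′)
         | count-unique (λ j → f 3 j b′) q (left₃ b′) | count-unique (λ j → f 3 j b) q (left₃ b)
    ... | i₀ , at-i₀ , i₀! | i₁ , at-i₁ , i₁! | j₀ , at-j₀ , j₀! | j₁ , at-j₁ , j₁! =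
      two-cells (f 1 p) (λ i → f 2 i q)
        (λ { refl → not-both-0 i₀ at-i₀ at-i₁ }) (λ { refl → not-both-3 j₀ at-j₁ at-j₀ }) free
      where
      1≱2 : ∀ {k} → k ≡ 1 → ¬ 2 ≤ k
      1≱2 refl (s≤s ())

      not-both-0 : ∀ i → f 0 a i ≡ p → f 0 a′ i ≡ p → ⊥
      not-both-0 i x y = 1≱2 (trans (sym (level≡ p i)) (cong toℕ (bal₀ i))) (count≥2 (λ a → f 0 a i) p a a′ a≢ x y)

      not-both-3 : ∀ j → f 3 j b ≡ q → f 3 j b′ ≡ q → ⊥
      not-both-3 j x y = 1≱2 (right₃ j) (count≥2 (f 3 j) q b b′ b≢ x y)

      kill : ∀ {i j a b} → f 1 p j ≢ i → f 2 i q ≢ j → Run (shift (shift (shift f))) (1 + m) q b a p →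
             f 3 j b ≡ q ⊎ f 0 a i ≡ p
      kill x y r = right-or-right λ { (u , v) → unbeaten W _ _ ((x ◃ (y ◃ (u ◃ r))) ▹ f₀⁻ v) }

      -- The two runs are caught by different vertices. Hence `i₀`, from the first run, is paired
      -- with `j₀`, from the second, and `i₁` with `j₁` the other way round.
      free : ∀ i j → f 1 p j ≢ i → f 2 i q ≢ j → i ≡ i₀ × j ≡ j₀ ⊎ i ≡ i₁ × j ≡ j₁
      free i j x y with kill x y r | kill x y r′
      ... | inj₁ s | inj₁ t = ⊥-elim (not-both-3 j s t)
      ... | inj₁ s | inj₂ t = inj₂ (i₁! i t , j₁! j s)
      ... | inj₂ s | inj₁ t = inj₁ (i₀! i s , j₀! j t)
      ... | inj₂ s | inj₂ t = ⊥-elim (not-both-0 i s t)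

origin slope₁ slope₂ : Rule → Colour
origin h = level h 0F 0F
slope₁ h = level h 1F 0F ⊕ ⊖ origin h
slope₂ h = level h 0F 1F ⊕ ⊖ origin h

module Levels {m} {f : ℕ → Rule} (W : Winner (5 + m) f) where

  private
    W₁ : Winner (5 + m) (shift f)
    W₁ = shift-winner W
    W₂ = shift-winner W₁
    W₃ = shift-winner W₂

    module E₀ = Edges W
    module E₃ = Edges W₃
    module E₄ = Edges (shift-winner W₃)

    colevel-1 : ∀ {k} {l : Colour} → k + toℕ l ≡ 2 → l ≡ 1F → k ≡ 1
    colevel-1 {1} p refl = refl
    colevel-1 {suc (suc k)} p refl = ⊥-elim (absurd (ℕ.suc-injective (ℕ.suc-injective p)))
      where
      absurd : k + 1 ≢ 0
      absurd q = case trans (ℕ.+-comm 1 k) q of λ ()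

  -- Balance is passed on from edge to edge until vertices 1 and 4 have colours `x₁` and `x₄` for
  -- which all counts on both sides are 1.
  no-balanced-row : ∀ p → ¬ Balanced (level (f 0) p)
  no-balanced-row p bal with E₀.balanced-column p bal
  ... | x₁ , left₁ with Edges.balanced-column W₁ x₁ (Windows.balanced-through W x₁ left₁)
  ... | x₂ , left₂ with Edges.balanced-column W₂ x₂ (Windows.balanced-through W₁ x₂ left₂)
  ... | x₃ , left₃ with Edges.balanced-column W₃ x₃ (Windows.balanced-through W₂ x₃ left₃)
  ... | x₄ , left₄ =
    Windows.no-balanced-pair W₁ x₁ x₄ (Windows.balanced-through W x₁ left₁)
      (λ a → colevel-1 (E₀.colevel a x₁) (left₁ a))
      (λ b → trans (sym (E₄.level≡ x₄ b)) (cong toℕ (Windows.balanced-through W₃ x₄ left₄ b)))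
      (λ j → colevel-1 (E₃.colevel j x₄) (left₄ j))

  row-injective : ∀ x y y′ → level (f 0) x y ≡ level (f 0) x y′ → y ≡ y′
  row-injective x = permutation (level (f 0) x) (E₀.row-sum x) (no-balanced-row x)

  column-injective : ∀ y x x′ → level (f 0) x y ≡ level (f 0) x′ y → x ≡ x′
  column-injective y = permutation (λ x → level (f 0) x y) (E₀.column-sum y) no-balanced-column
    where
    no-balanced-column : ¬ Balanced (λ x → level (f 0) x y)
    no-balanced-column bal with other-two y
    ... | y′ , _ , y′≢y , _ with has-one (λ x → level (f 0) x y′) (E₀.column-sum y′)
    ... | x , one = no-balanced-row x (third-one (level (f 0) x) y′ y y′≢y (E₀.row-sum x) one (bal x))

  level-affine : ∀ x y → level (f 0) x y ≡ origin (f 0) ⊕ (slope₁ (f 0) ⊛ x) ⊕ (slope₂ (f 0) ⊛ y)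
  level-affine = latin⇒affine (level (f 0)) row-injective column-injective

  slope₁≢0 : slope₁ (f 0) ≢ 0F
  slope₁≢0 p = case column-injective 0F 0F 1F (sym (⊖-zero _ _ p)) of λ ()

  slope₂≢0 : slope₂ (f 0) ≢ 0F
  slope₂≢0 p = case row-injective 0F 0F 1F (sym (⊖-zero _ _ p)) of λ ()

module Consecutive {m} {f : ℕ → Rule} (W : Winner (5 + m) f) where

  private
    module E₀ = Edges W
    module E₁ = Edges (shift-winner W)
    module L₀ = Levels W
    module L₁ = Levels (shift-winner W)

  equal-levels-wrong : ∀ {a x b} → level (f 0) a x ≡ level (f 1) x b → f 1 a b ≢ x
  equal-levels-wrong {a} {x} {b} eq = tight-wrong (level (f 1) x) (f 1 a) (level (f 0) a x) x
    (E₁.row-sum x) (L₁.no-balanced-row x) (E₀.colevel a x)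
    (λ b ne → Windows.level-mono W ne) b (sym eq)

  -- Equal slopes would make the two levels at vertex 1 agree whatever its colour is,
  -- and then its guess would be wrong for every colour.
  slopes-opposite : slope₂ (f 0) ≡ ⊖ slope₁ (f 1)
  slopes-opposite = dichotomy _ _ L₀.slope₂≢0 L₁.slope₁≢0 λ same →
    equal-levels-wrong {0F} {f 1 0F b} {b} (trans (L₀.level-affine 0F (f 1 0F b))
      (trans (balance (origin (f 0)) (origin (f 1)) (slope₁ (f 0)) (slope₂ (f 0)) (slope₂ (f 1)) (f 1 0F b)
                      L₁.slope₂≢0 same)
             (sym (L₁.level-affine (f 1 0F b) b)))) refl
    where
    -- Nonzero residues modulo 3 are their own inverses, so this is the solution `b` of the equation
    -- between the two levels once the terms in x cancel.
    b : Colour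
    b = slope₂ (f 1) ⊛ (origin (f 0) ⊕ ⊖ origin (f 1))

    dichotomy : ∀ u v → u ≢ 0F → v ≢ 0F → u ≢ v → u ≡ ⊖ v
    dichotomy = from-yes (every? λ u → every? λ v → ¬? (u ≟ 0F) →-dec (¬? (v ≟ 0F) →-dec (¬? (u ≟ v) →-dec (u ≟ ⊖ v))))

    balance : ∀ c c′ p q q′ x → q′ ≢ 0F → {p′ : Colour} → q ≡ p′ →
              c ⊕ (p ⊛ 0F) ⊕ (q ⊛ x) ≡ c′ ⊕ (p′ ⊛ x) ⊕ (q′ ⊛ (q′ ⊛ (c ⊕ ⊖ c′)))
    balance c c′ p q q′ x ne refl = lemma c c′ p q q′ x ne
      where
      lemma : ∀ c c′ p q q′ x → q′ ≢ 0F →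
              c ⊕ (p ⊛ 0F) ⊕ (q ⊛ x) ≡ c′ ⊕ (q ⊛ x) ⊕ (q′ ⊛ (q′ ⊛ (c ⊕ ⊖ c′)))
      lemma = from-yes (every? λ c → every? λ c′ → every? λ p → every? λ q → every? λ q′ → every? λ x → ¬? (q′ ≟ 0F) →-dec
        (c ⊕ (p ⊛ 0F) ⊕ (q ⊛ x) ≟ c′ ⊕ (q ⊛ x) ⊕ (q′ ⊛ (q′ ⊛ (c ⊕ ⊖ c′)))))

-- The placement of constant level

shifts : (ℕ → Rule) → ℕ → ℕ → Rule
shifts f zero    = f
shifts f (suc i) = shift (shifts f i)

shifts-+ : ∀ f i j → shifts f i j ≡ f (i + j)
shifts-+ f zero    j = refl
shifts-+ f (suc i) j = trans (shifts-+ f i (suc j)) (cong f (ℕ.+-suc i j))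

shifts-winner : ∀ {n f} → Winner (suc n) f → ∀ i → Winner (suc n) (shifts f i)
shifts-winner W zero    = W
shifts-winner W (suc i) = shift-winner (shifts-winner W i)

mod₃ : ℕ → Colour
mod₃ zero    = 0F
mod₃ (suc k) = mod₃ k ⊕ 1F

mod₃≡0⇒3∣ : ∀ k → mod₃ k ≡ 0F → 3 ∣ k
mod₃≡0⇒3∣ 0 p = divides 0 refl
mod₃≡0⇒3∣ (suc (suc (suc k))) p = ∣m∣n⇒∣m+n {3} {3} {k} (divides 1 refl) (mod₃≡0⇒3∣ k (trans (sym (⊕-three (mod₃ k))) p))

no-winner : ∀ {m f} → ¬ 3 ∣ 5 + m → ¬ Winner (5 + m) f
no-winner {m} {f} 3∤n W = unbeaten W (x 0) (x 1)
  (subst₂ (Run f n (x 0) (x 1)) x-closed x-closed′ (run n))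
  where
  n : ℕ
  n = 5 + m

  -- Through `shifts`, the rules `h i` and `h (suc i)` are definitionally the rules 0 and 1 of the
  -- rotated winner.
  h : ℕ → Rule
  h i = shifts f i 0

  -- t accumulates, in the coordinate in which the slopes become 1 and −1, the increments
  -- that keep every level equal to ℓ; it closes up after n steps because 3 ∤ n.
  t : Colour → ℕ → Colour
  t ℓ zero    = 0F
  t ℓ (suc i) = t ℓ i ⊕ origin (h i) ⊕ ⊖ ℓ

  t-linear : ∀ ℓ k → t ℓ k ≡ t 0F k ⊕ ⊖ (mod₃ k ⊛ ℓ)
  t-linear ℓ zero    = refl
  t-linear ℓ (suc k) = trans (cong (λ u → u ⊕ origin (h k) ⊕ ⊖ ℓ) (t-linear ℓ k)) (lemma (t 0F k) (mod₃ k) ℓ (origin (h k)))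
    where
    lemma : ∀ u v ℓ c → (u ⊕ ⊖ (v ⊛ ℓ)) ⊕ c ⊕ ⊖ ℓ ≡ (u ⊕ c ⊕ ⊖ 0F) ⊕ ⊖ ((v ⊕ 1F) ⊛ ℓ)
    lemma = from-yes (every? λ u → every? λ v → every? λ ℓ → every? λ c →
      (u ⊕ ⊖ (v ⊛ ℓ)) ⊕ c ⊕ ⊖ ℓ ≟ (u ⊕ c ⊕ ⊖ 0F) ⊕ ⊖ ((v ⊕ 1F) ⊛ ℓ))

  -- By `t-linear`, closing up means n ℓ = t 0 n modulo 3, and n is its own inverse there.
  ℓ : Colour
  ℓ = mod₃ n ⊛ t 0F n

  t-closed : t ℓ n ≡ 0F
  t-closed = trans (t-linear ℓ n) (lemma (t 0F n) (mod₃ n) (3∤n ∘ mod₃≡0⇒3∣ n))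
    where
    lemma : ∀ u v → v ≢ 0F → u ⊕ ⊖ (v ⊛ (v ⊛ u)) ≡ 0F
    lemma = from-yes (every? λ u → every? λ v → ¬? (v ≟ 0F) →-dec (u ⊕ ⊖ (v ⊛ (v ⊛ u)) ≟ 0F))

  x : ℕ → Colour
  x i = slope₁ (h i) ⊛ t ℓ i

  level-x : ∀ i → level (h i) (x i) (x (suc i)) ≡ ℓ
  level-x i = trans (Levels.level-affine Wᵢ (x i) (x (suc i)))
    (trans (cong (λ q → origin (h i) ⊕ (slope₁ (h i) ⊛ x i) ⊕ (q ⊛ x (suc i))) (Consecutive.slopes-opposite Wᵢ))
      (lemma (origin (h i)) (t ℓ i) ℓ (slope₁ (h i)) (slope₁ (h (suc i)))
        (Levels.slope₁≢0 Wᵢ) (Levels.slope₁≢0 (shift-winner Wᵢ))))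
    where
    Wᵢ : Winner n (shifts f i)
    Wᵢ = shifts-winner W i
    lemma : ∀ c t ℓ p p′ → p ≢ 0F → p′ ≢ 0F →
            c ⊕ (p ⊛ (p ⊛ t)) ⊕ ((⊖ p′) ⊛ (p′ ⊛ (t ⊕ c ⊕ ⊖ ℓ))) ≡ ℓ
    lemma = from-yes (every? λ c → every? λ t → every? λ ℓ → every? λ p → every? λ p′ → ¬? (p ≟ 0F) →-dec
      (¬? (p′ ≟ 0F) →-dec (c ⊕ (p ⊛ (p ⊛ t)) ⊕ ((⊖ p′) ⊛ (p′ ⊛ (t ⊕ c ⊕ ⊖ ℓ))) ≟ ℓ)))

  wrong : ∀ i → f (suc i) (x i) (x (suc (suc i))) ≢ x (suc i)
  wrong i = subst (λ g → g (x i) (x (suc (suc i))) ≢ x (suc i))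
    (trans (shifts-+ f i 1) (cong f (ℕ.+-comm i 1)))
    (Consecutive.equal-levels-wrong (shifts-winner W i) (trans (level-x i) (sym (level-x (suc i)))))

  run : ∀ k → Run f k (x 0) (x 1) (x k) (x (suc k))
  run zero    = []
  run (suc k) = run k ▹ wrong k

  h-periodic : h n ≡ h 0
  h-periodic = trans (shifts-+ f n 0) (trans (cong f (ℕ.+-identityʳ n)) (periodic W 0))

  h-periodic′ : h (suc n) ≡ h 1
  h-periodic′ = trans (shifts-+ f n 1) (trans (cong f (ℕ.+-comm n 1)) (periodic W 1))

  x-closed : x n ≡ x 0
  x-closed = cong₂ (λ g u → slope₁ g ⊛ u) h-periodic t-closed

  x-closed′ : x (suc n) ≡ x 1
  x-closed′ = cong₂ (λ g u → slope₁ g ⊛ u) h-periodic′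
    (cong₂ (λ u g → u ⊕ origin g ⊕ ⊖ ℓ) t-closed h-periodic)

-- Guessing along a path

bits : Bool → Bool → Bool → Colour → Bool
bits u v w 0F = u
bits u v w 1F = v
bits u v w 2F = w

is : Colour → Colour → Bool
is c d = does (c ≟ d)

-- Along a path on which every vertex guesses by `arrow` and is wrong, the end colours tell at
-- least one of the outer vertices one bit of its own colour: is it 1 (left), is it 0 (right)?
arrow : Rule
arrow b 0F = 1F
arrow b _  = if is b 1F then 2F else 0F

-- The end colours a, b possible on such a path with at least two inner vertices, when β says
-- whether the left outer colour is 1 and γ whether the right one is 0.
joined : Bool → Bool → Colour → Colour → Bool
joined false false 0F = bits false false false
joined false false 1F = bits false true  false
joined false false 2F = bits false true  true
joined false true  0F = bits true  false false
joined false true  1F = bits true  false true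
joined false true  2F = bits true  false true
joined true  true  0F = bits true  false true
joined true  true  1F = bits true  false true
joined true  true  2F = bits true  false false
joined true  false 0F = bits false true  true
joined true  false 1F = bits false true  false
joined true  false 2F = bits false false false

opaque
  joined-start : ∀ l a c → arrow l c ≢ a → ∀ d → arrow a d ≢ c → T (joined (is l 1F) (is d 0F) a c)
  joined-start = from-yes (every? λ l → every? λ a → every? λ c → ¬? (arrow l c ≟ a) →-dec (every? λ d →
    ¬? (arrow a d ≟ c) →-dec Bool.T? (joined (is l 1F) (is d 0F) a c)))

  joined-step : ∀ l a b c → T (joined (is l 1F) (is c 0F) a b) → ∀ d → arrow b d ≢ c →
                T (joined (is l 1F) (is d 0F) a c)
  joined-step = from-yes (every? λ l → every? λ a → every? λ b → every? λ c → Bool.T? (joined (is l 1F) (is c 0F) a b) →-dec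
    (every? λ d → ¬? (arrow b d ≟ c) →-dec Bool.T? (joined (is l 1F) (is d 0F) a c)))

-- Weaker than `joined`, but true for a single inner vertex as well.
pointing : Colour → Colour → Colour → Colour → Set
pointing l a b c = is a 0F ≡ is l 1F ⊎ not (is b 1F) ≡ is c 0F

pointing? : ∀ l a b c → Dec (pointing l a b c)
pointing? l a b c = (is a 0F Bool.≟ is l 1F) ⊎-dec (not (is b 1F) Bool.≟ is c 0F)

opaque
  pointing-start : ∀ l a c → arrow l c ≢ a → pointing l a a c
  pointing-start = from-yes (every? λ l → every? λ a → every? λ c → ¬? (arrow l c ≟ a) →-dec pointing? l a a c)

  pointing-step : ∀ l a b c → pointing l a b c → ∀ d → arrow b d ≢ c → pointing l a c d
  pointing-step = from-yes (every? λ l → every? λ a → every? λ b → every? λ c → pointing? l a b c →-dec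
    (every? λ d → ¬? (arrow b d ≟ c) →-dec pointing? l a c d))

-- `arrow` only tests whether its left neighbour is 1, which would send a single bit of the left end
-- down the path; `hook` separates all three colours.
hook : Rule
hook 0F c = 0F
hook l  c = arrow l c

-- The analogue of `joined` when the path starts with `hook`. It starts with a = b, so it covers a
-- single inner vertex too.
hooked : Colour → Bool → Colour → Colour → Bool
hooked 0F _     0F = bits false false false
hooked 0F _     1F = bits true  true  true
hooked 0F true  2F = bits true  false true
hooked 0F false 2F = bits false true  true
hooked 1F true  _  = bits true  false true
hooked 1F false 0F = bits true  true  true
hooked 1F false 1F = bits false true  false
hooked 1F false 2F = bits false false false
hooked 2F γ     a  = joined false γ a

opaque
  hooked-start : ∀ l a c → hook l c ≢ a → T (hooked l (is c 0F) a a)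
  hooked-start = from-yes (every? λ l → every? λ a → every? λ c → ¬? (hook l c ≟ a) →-dec Bool.T? (hooked l (is c 0F) a a))

  hooked-step : ∀ l a b c → T (hooked l (is c 0F) a b) → ∀ d → arrow b d ≢ c → T (hooked l (is d 0F) a c)
  hooked-step = from-yes (every? λ l → every? λ a → every? λ b → every? λ c → Bool.T? (hooked l (is c 0F) a b) →-dec
    (every? λ d → ¬? (arrow b d ≟ c) →-dec Bool.T? (hooked l (is d 0F) a c)))

-- The guesses of the two branch vertices z and y of a theta graph. The first path carries `hook`
-- guesses, the second (from y to z) and the third carry `arrow` guesses; the tables were found
-- by solving the resulting finite constraint problem.
theta-z theta-y : Colour → Colour → Colour → Colour
theta-z a₁ a₂ a₃ = tab
  (tab (tab 0F 0F 0F a₁) (tab 0F 0F 0F a₁) (tab 0F 0F 0F a₁) a₃)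
  (tab (tab 2F 2F 2F a₁) (tab 1F 1F 2F a₁) (tab 1F 1F 1F a₁) a₃)
  (tab (tab 0F 0F 2F a₁) (tab 1F 0F 0F a₁) (tab 1F 0F 0F a₁) a₃) a₂
theta-y b₁ b₂ b₃ = tab
  (tab (tab 0F 0F 0F b₁) (tab 0F 0F 0F b₁) (tab 0F 0F 0F b₁) b₃)
  (tab (tab 2F 2F 2F b₁) (tab 0F 1F 0F b₁) (tab 2F 0F 2F b₁) b₃)
  (tab (tab 2F 2F 2F b₁) (tab 0F 1F 1F b₁) (tab 2F 1F 2F b₁) b₃) b₂

opaque
  theta-path : ∀ z y a₁ b₁ → T (hooked z (not (is y 1F)) a₁ b₁) →
    ∀ a₂ b₂ → T (joined (is y 0F) (is z 0F) b₂ a₂) → ∀ a₃ b₃ → T (joined (is z 2F) (is y 2F) a₃ b₃) →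
    theta-z a₁ a₂ a₃ ≢ z → theta-y b₁ b₂ b₃ ≢ y → ⊥
  theta-path = from-yes (every? λ z → every? λ y → every? λ a₁ → every? λ b₁ → Bool.T? (hooked z (not (is y 1F)) a₁ b₁) →-dec
    (every? λ a₂ → every? λ b₂ → Bool.T? (joined (is y 0F) (is z 0F) b₂ a₂) →-dec
    (every? λ a₃ → every? λ b₃ → Bool.T? (joined (is z 2F) (is y 2F) a₃ b₃) →-dec
    (¬? (theta-z a₁ a₂ a₃ ≟ z) →-dec ¬? (¬? (theta-y b₁ b₂ b₃ ≟ y))))))

  theta-edge : ∀ z y a₂ b₂ a₃ b₃ →
    T (joined (is y 0F) (is z 0F) b₂ a₂) → T (joined (is z 2F) (is y 2F) a₃ b₃) →
    theta-z (tab 1F 2F 0F y) a₂ a₃ ≢ z → theta-y z b₂ b₃ ≢ y → ⊥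
  theta-edge = from-yes (every? λ z → every? λ y → every? λ a₂ → every? λ b₂ → every? λ a₃ → every? λ b₃ →
    Bool.T? (joined (is y 0F) (is z 0F) b₂ a₂) →-dec (Bool.T? (joined (is z 2F) (is y 2F) a₃ b₃) →-dec
    (¬? (theta-z (tab 1F 2F 0F y) a₂ a₃ ≟ z) →-dec ¬? (¬? (theta-y z b₂ b₃ ≟ y)))))

-- The guess x between neighbours b and d for which d − x exceeds x − b; if it is wrong,
-- the successive differences do not increase.
climb : Rule
climb b d = if is b d then b ⊕ 1F else b

-- Differences are read as 0, 1, 2. No later step exceeds the first one, a - z, and equality means
-- that all steps so far were equal. Then `b` lies κ such steps from `z`, where κ counts them modulo
-- 3.
Descent : Colour → Colour → Colour → Colour → Colour → Set
Descent κ z a b c = toℕ (c ⊕ ⊖ b) ≤ toℕ (a ⊕ ⊖ z) × (c ⊕ ⊖ b ≡ a ⊕ ⊖ z → b ≡ z ⊕ (κ ⊛ (a ⊕ ⊖ z)))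

descent? : ∀ κ z a b c → Dec (Descent κ z a b c)
descent? κ z a b c = (toℕ (c ⊕ ⊖ b) ℕ.≤? toℕ (a ⊕ ⊖ z)) ×-dec
  ((c ⊕ ⊖ b ≟ a ⊕ ⊖ z) →-dec (b ≟ z ⊕ (κ ⊛ (a ⊕ ⊖ z))))

opaque
  descent-start : ∀ z a c → climb z c ≢ a → Descent 1F z a a c
  descent-start = from-yes (every? λ z → every? λ a → every? λ c → ¬? (climb z c ≟ a) →-dec descent? 1F z a a c)

  descent-step : ∀ κ z a b c → Descent κ z a b c → ∀ d → climb b d ≢ c → Descent (κ ⊕ 1F) z a c d
  descent-step = from-yes (every? λ κ → every? λ z → every? λ a → every? λ b → every? λ c → descent? κ z a b c →-dec
    (every? λ d → ¬? (climb b d ≟ c) →-dec descent? (κ ⊕ 1F) z a c d))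

  -- The last vertex is shown z + 1 for z, and z is shown b - 1 for b, so both read the closing step
  -- as z + 1 - b. If all are wrong, it equals the first step δ. But κ = -1 gives b = z - δ, so it
  -- is δ + 1.
  descent-end : ∀ κ z a b → κ ⊕ 1F ≡ 0F → Descent κ z a b (z ⊕ 1F) → climb (b ⊕ 2F) a ≢ z → ⊥
  descent-end = from-yes (every? λ κ → every? λ z → every? λ a → every? λ b → (κ ⊕ 1F ≟ 0F) →-dec
    (descent? κ z a b (z ⊕ 1F) →-dec ¬? (¬? (climb (b ⊕ 2F) a ≟ z))))

3∣⇒mod₃≡0 : ∀ k → 3 ∣ k → mod₃ k ≡ 0F
3∣⇒mod₃≡0 k (divides q refl) = multiple q
  where
  multiple : ∀ q → mod₃ (q * 3) ≡ 0F
  multiple zero    = refl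
  multiple (suc q) = trans (⊕-three (mod₃ (q * 3))) (multiple q)

-- Strategies supported on a subgraph

module Plans (G : Graph) where

  V : Set
  V = Fin (Graph.n G)

  Adj-sym : ∀ {u v} → Adj G u v → Adj G v u
  Adj-sym {u} {v} p = trans (Graph.sym G v u) p

  record Entry : Set where
    field
      at    : V
      say   : Placement G → Colour
      local : ∀ C C′ → (∀ u → Adj G at u → C u ≡ C′ u) → say C ≡ say C′

  open Entry public

  Wrong : Placement G → Entry → Set
  Wrong C e = say e C ≢ C (at e)

  pick : List Entry → V → Placement G → Colour
  pick []       v C = 0F
  pick (e ∷ es) v C with at e ≟ v
  ... | yes _ = say e C
  ... | no  _ = pick es v C

  pick-local : ∀ es v C C′ → (∀ u → Adj G v u → C u ≡ C′ u) → pick es v C ≡ pick es v C′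
  pick-local []       v C C′ p = refl
  pick-local (e ∷ es) v C C′ p with at e ≟ v
  ... | yes refl = local e C C′ p
  ... | no  _    = pick-local es v C C′ p

  pick-∈ : ∀ {e} es C → Unique (map at es) → e ∈ es → pick es (at e) C ≡ say e C
  pick-∈ {e} (e ∷ es) C _ (here refl) with at e ≟ at e
  ... | yes _ = refl
  ... | no ne = ⊥-elim (ne refl)
  pick-∈ {e} (e′ ∷ es) C (e′∉ ∷ u) (there p) with at e′ ≟ at e
  ... | yes q = ⊥-elim (All.lookup e′∉ (∈-map⁺ at p) q)
  ... | no  _ = pick-∈ es C u p

  plan-wins : ∀ es → Unique (map at es) → (∀ C → ¬ All (Wrong C) es) → SagesWin G
  plan-wins es u beats = record { guess = pick es ; local = pick-local es } , winning
    where
    winning : ∀ C → ∃ λ v → pick es v C ≡ C v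
    winning C with Any.any? (λ e → say e C ≟ C (at e)) es
    ... | no none = ⊥-elim (beats C (All.¬Any⇒All¬ es none))
    ... | yes some with find some
    ... | e , e∈es , p = at e , trans (pick-∈ es C u e∈es) p

  -- Only inner vertices are listed: the empty list is an edge, and a chain from a vertex to itself
  -- goes round a closed walk.
  Chain : V → List V → V → Set
  Chain u []       v = Adj G u v
  Chain u (p ∷ ps) v = Adj G u p × Chain p ps v

  firstOf : List V → V → V
  firstOf []      v = v
  firstOf (p ∷ _) v = p

  lastOf : V → List V → V
  lastOf u []       = u
  lastOf u (p ∷ ps) = lastOf p ps

  chain-first : ∀ {u} ps {v} → Chain u ps v → Adj G u (firstOf ps v)
  chain-first []       c       = c
  chain-first (p ∷ ps) (a , _) = a

  chain-last : ∀ {u} ps {v} → Chain u ps v → Adj G v (lastOf u ps)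
  chain-last []       c       = Adj-sym c
  chain-last (p ∷ ps) (_ , c) = chain-last ps c

  chain-++ : ∀ {u} ps {w} qs {v} → Chain u ps w → Chain w qs v → Chain u (ps ++ w ∷ qs) v
  chain-++ []       qs c       d = c , d
  chain-++ (p ∷ ps) qs (a , c) d = a , chain-++ ps qs c d

  chain-++⁻ : ∀ {u} ps {w} qs {v} → Chain u (ps ++ w ∷ qs) v → Chain u ps w × Chain w qs v
  chain-++⁻ []       qs (a , d) = a , d
  chain-++⁻ (p ∷ ps) qs (a , c) = let (c′ , d) = chain-++⁻ ps qs c in (a , c′) , d

  chain-reverse : ∀ {u} ps {v} → Chain u ps v → Chain v (reverse ps) u
  chain-reverse []       c = Adj-sym c
  chain-reverse {u} (p ∷ ps) {v} (a , c) =
    subst (λ qs → Chain v qs u) (sym (unfold-reverse p ps)) (chain-++ (reverse ps) [] (chain-reverse ps c) (Adj-sym a))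

  nextColour : (Colour → Colour) → List V → V → Placement G → Colour
  nextColour φ []      v C = φ (C v)
  nextColour φ (p ∷ _) v C = C p

  nextColour-local : ∀ φ {u} ps {v} → Chain u ps v → ∀ C C′ → (∀ w → Adj G u w → C w ≡ C′ w) →
    nextColour φ ps v C ≡ nextColour φ ps v C′
  nextColour-local φ []       c       C C′ p = cong φ (p _ c)
  nextColour-local φ (q ∷ qs) (a , _) C C′ p = p _ a

  -- The first vertex has its own rule `r` and the last one is shown `φ` of the colour of `v`. This
  -- codes an end colour as a bit, or twists it.
  route : (r s : Rule) (φ : Colour → Colour) → ∀ u ps v → Chain u ps v → List Entry
  route r s φ u []       v c       = []
  route r s φ u (p ∷ ps) v (a , c) = record
    { at    = p
    ; say   = λ C → r (C u) (nextColour φ ps v C)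
    ; local = λ C C′ eq → cong₂ r (eq u (Adj-sym a)) (nextColour-local φ ps c C C′ eq)
    } ∷ route s s φ p ps v c

  route-sites : ∀ r s φ u ps v c → map at (route r s φ u ps v c) ≡ ps
  route-sites r s φ u []       v c       = refl
  route-sites r s φ u (p ∷ ps) v (a , c) = cong (p ∷_) (route-sites s s φ p ps v c)

  route-invariant : ∀ (I : ℕ → Colour → Colour → Set) {s} →
    (∀ k b c → I k b c → ∀ d → s b d ≢ c → I (suc k) c d) →
    ∀ C k r φ u p ps v c → (∀ c → r (C u) c ≢ C p → I k (C p) c) →
    All (Wrong C) (route r s φ u (p ∷ ps) v c) → I (k + length ps) (C (lastOf p ps)) (φ (C v))
  route-invariant I advance C k r φ u p [] v c start (w ∷ []) =
    subst (λ k → I k (C p) (φ (C v))) (sym (ℕ.+-identityʳ k)) (start _ w)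
  route-invariant I {s} advance C k r φ u p (q ∷ ps) v (_ , c) start (w ∷ ws) =
    subst (λ k → I k (C (lastOf q ps)) (φ (C v))) (sym (ℕ.+-suc k (length ps)))
      (route-invariant I advance C (suc k) s φ p q ps v c (advance k (C p) (C q) (start (C q) w)) ws)

  inward outward : (Colour → Bool) → Colour → Colour
  inward  σ c = if σ c then 1F else 2F
  outward τ c = if τ c then 0F else 1F

  is-inward : ∀ σ c → is (inward σ c) 1F ≡ σ c
  is-inward σ c with σ c
  ... | true  = refl
  ... | false = refl

  is-outward : ∀ τ c → is (outward τ c) 0F ≡ τ c
  is-outward τ c with τ c
  ... | true  = refl
  ... | false = refl

  arrows : (σ τ : Colour → Bool) → ∀ u ps v → Chain u ps v → List Entry
  arrows σ τ = route (arrow ∘ inward σ) arrow (outward τ)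

  arrows-sites : ∀ σ τ u ps v c → map at (arrows σ τ u ps v c) ≡ ps
  arrows-sites σ τ = route-sites (arrow ∘ inward σ) arrow (outward τ)

  arrows-joined : ∀ σ τ C u p q ps v c → All (Wrong C) (arrows σ τ u (p ∷ q ∷ ps) v c) →
    T (joined (σ (C u)) (τ (C v)) (C p) (C (lastOf q ps)))
  arrows-joined σ τ C u p q ps v c ws =
    subst₂ (λ β γ → T (joined β γ (C p) (C (lastOf q ps)))) (is-inward σ (C u)) (is-outward τ (C v))
      (route-invariant I advance C 0 (arrow ∘ inward σ) (outward τ) u p (q ∷ ps) v c (λ d w → refl , w) ws)
    where
    l : Colour
    l = inward σ (C u)

    -- `joined` needs two inner vertices, so stage 0 only remembers the first wrong guess.
    I : ℕ → Colour → Colour → Set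
    I zero    b d = b ≡ C p × arrow l d ≢ C p
    I (suc _) b d = T (joined (is l 1F) (is d 0F) (C p) b)

    advance : ∀ k b c → I k b c → ∀ d → arrow b d ≢ c → I (suc k) c d
    advance zero    b c (refl , w) d w′ = joined-start l b c w d w′
    advance (suc k) b c j          d w  = joined-step l (C p) b c j d w

  arrows-pointing : ∀ σ τ C u p ps v c → All (Wrong C) (arrows σ τ u (p ∷ ps) v c) →
    is (C p) 0F ≡ σ (C u) ⊎ not (is (C (lastOf p ps)) 1F) ≡ τ (C v)
  arrows-pointing σ τ C u p ps v c ws =
    subst₂ (λ β γ → is (C p) 0F ≡ β ⊎ not (is (C (lastOf p ps)) 1F) ≡ γ) (is-inward σ (C u)) (is-outward τ (C v))
      (route-invariant (λ _ b d → pointing l (C p) b d) (λ _ → pointing-step l (C p))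
        C 0 (arrow ∘ inward σ) (outward τ) u p ps v c (pointing-start l (C p)) ws)
    where
    l : Colour
    l = inward σ (C u)

  hooks-hooked : ∀ τ C u p ps v c → All (Wrong C) (route hook arrow (outward τ) u (p ∷ ps) v c) →
    T (hooked (C u) (τ (C v)) (C p) (C (lastOf p ps)))
  hooks-hooked τ C u p ps v c ws =
    subst (λ γ → T (hooked (C u) γ (C p) (C (lastOf p ps)))) (is-outward τ (C v))
      (route-invariant (λ _ b d → T (hooked (C u) (is d 0F) (C p) b)) (λ _ → hooked-step (C u) (C p))
        C 0 hook (outward τ) u p ps v c (hooked-start (C u) (C p)) ws)

  Unique-↭ : ∀ {xs ys : List V} → xs ↭ ys → Unique xs → Unique ys
  Unique-↭ p = ↭ₛ.Unique-resp-↭ (setoid V) (↭⇒↭ₛ p)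

  -- Two loops at z: each of them tells z one bit about its own colour.
  figure-eight : ∀ z p q ps p′ q′ ps′ →
    Chain z (p ∷ q ∷ ps) z → Chain z (p′ ∷ q′ ∷ ps′) z →
    Unique (z ∷ (p ∷ q ∷ ps) ++ (p′ ∷ q′ ∷ ps′)) → SagesWin G
  figure-eight z p q ps p′ q′ ps′ c c′ u =
    plan-wins (e ∷ es ++ es′) (subst Unique (cong (z ∷_) (sym sites)) u) λ { C (w ∷ ws) →
      lemma (C z) (C p) (C (lastOf q ps)) (C p′) (C (lastOf q′ ps′))
        (arrows-joined (is 0F) (is 0F) C z p q ps z c (All.++⁻ˡ es ws))
        (arrows-joined (is 1F) (is 1F) C z p′ q′ ps′ z c′ (All.++⁻ʳ es ws)) w }
    where
    es es′ : List Entry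
    es  = arrows (is 0F) (is 0F) z (p ∷ q ∷ ps) z c
    es′ = arrows (is 1F) (is 1F) z (p′ ∷ q′ ∷ ps′) z c′

    verdict : Colour → Colour → Colour → Colour → Colour
    verdict a b a′ b′ = if joined true true a b then 0F else if joined true true a′ b′ then 1F else 2F

    e : Entry
    e = record
      { at    = z
      ; say   = λ C → verdict (C p) (C (lastOf q ps)) (C p′) (C (lastOf q′ ps′))
      ; local = λ C C′ eq → cong₂ _$_ (cong₂ _$_ (cong₂ verdict (eq p (proj₁ c)) (eq _ (chain-last (p ∷ q ∷ ps) c)))
                                     (eq p′ (proj₁ c′))) (eq _ (chain-last (p′ ∷ q′ ∷ ps′) c′))
      }

    sites : map at (es ++ es′) ≡ (p ∷ q ∷ ps) ++ (p′ ∷ q′ ∷ ps′)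
    sites = trans (map-++ at es es′)
      (cong₂ _++_ (arrows-sites (is 0F) (is 0F) z (p ∷ q ∷ ps) z c) (arrows-sites (is 1F) (is 1F) z (p′ ∷ q′ ∷ ps′) z c′))

    lemma : ∀ z a b a′ b′ → T (joined (is 0F z) (is 0F z) a b) → T (joined (is 1F z) (is 1F z) a′ b′) →
            verdict a b a′ b′ ≢ z → ⊥
    lemma = from-yes (every? λ z → every? λ a → every? λ b → every? λ a′ → every? λ b′ →
      Bool.T? (joined (is 0F z) (is 0F z) a b) →-dec (Bool.T? (joined (is 1F z) (is 1F z) a′ b′) →-dec
      ¬? (¬? (verdict a b a′ b′ ≟ z))))

  -- A bare edge is the classical game of two sages with two colours: two bits agree or differ, and
  -- each end bets on one of these.
  chain-pointing : ∀ C u ps v c →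
    All (Wrong C) (arrows (λ c → is c 1F) (λ c → is c 0F) u ps v c) →
    is (C (firstOf ps v)) 0F ≡ is (C u) 1F ⊎ not (is (C (lastOf u ps)) 1F) ≡ is (C v) 0F
  chain-pointing C u []       v c _  with is (C u) 1F | is (C v) 0F
  ... | true  | true  = inj₁ refl
  ... | true  | false = inj₂ refl
  ... | false | true  = inj₂ refl
  ... | false | false = inj₁ refl
  chain-pointing C u (p ∷ ps) v c ws = arrows-pointing (λ c → is c 1F) (λ c → is c 0F) C u p ps v c ws

  -- The loops tell the hubs z and y whether their colours are 2; if not, the path between
  -- them is a path with two colours at both ends.
  dumbbell : ∀ z p q ps rs y p′ q′ ps′ →
    Chain z (p ∷ q ∷ ps) z → Chain z rs y → Chain y (p′ ∷ q′ ∷ ps′) y →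
    Unique (z ∷ y ∷ (p ∷ q ∷ ps) ++ rs ++ (p′ ∷ q′ ∷ ps′)) → SagesWin G
  dumbbell z p q ps rs y p′ q′ ps′ c d c′ u =
    plan-wins (ez ∷ ey ∷ es ++ fs ++ es′) (subst Unique (cong (λ vs → z ∷ y ∷ vs) (sym sites)) u) λ { C (w ∷ w′ ∷ ws) →
      lemma (C z) (C y) (C p) (C (lastOf q ps)) (C p′) (C (lastOf q′ ps′)) (C (firstOf rs y)) (C (lastOf z rs))
        (arrows-joined (λ c → is c 2F) (λ c → is c 2F) C z p q ps z c (All.++⁻ˡ es ws))
        (arrows-joined (λ c → is c 2F) (λ c → is c 2F) C y p′ q′ ps′ y c′ (All.++⁻ʳ fs (All.++⁻ʳ es ws)))
        (chain-pointing C z rs y d (All.++⁻ˡ fs (All.++⁻ʳ es ws))) w w′ }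
    where
    es fs es′ : List Entry
    es  = arrows (λ c → is c 2F) (λ c → is c 2F) z (p ∷ q ∷ ps) z c
    fs  = arrows (λ c → is c 1F) (λ c → is c 0F) z rs y d
    es′ = arrows (λ c → is c 2F) (λ c → is c 2F) y (p′ ∷ q′ ∷ ps′) y c′

    verdict-z verdict-y : Colour → Colour → Colour → Colour
    verdict-z a b r = if joined true true a b then 2F else if is r 0F then 1F else 0F
    verdict-y a b r = if joined true true a b then 2F else if not (is r 1F) then 0F else 1F

    ez ey : Entry
    ez = record
      { at    = z
      ; say   = λ C → verdict-z (C p) (C (lastOf q ps)) (C (firstOf rs y))
      ; local = λ C C′ eq → cong₂ _$_ (cong₂ verdict-z (eq p (proj₁ c)) (eq _ (chain-last (p ∷ q ∷ ps) c)))
                                      (eq _ (chain-first rs d))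
      }
    ey = record
      { at    = y
      ; say   = λ C → verdict-y (C p′) (C (lastOf q′ ps′)) (C (lastOf z rs))
      ; local = λ C C′ eq → cong₂ _$_ (cong₂ verdict-y (eq p′ (proj₁ c′)) (eq _ (chain-last (p′ ∷ q′ ∷ ps′) c′)))
                                      (eq _ (chain-last rs d))
      }

    sites : map at (es ++ fs ++ es′) ≡ (p ∷ q ∷ ps) ++ rs ++ (p′ ∷ q′ ∷ ps′)
    sites = trans (map-++ at es (fs ++ es′)) (cong₂ _++_ (arrows-sites (λ c → is c 2F) (λ c → is c 2F) z (p ∷ q ∷ ps) z c)
      (trans (map-++ at fs es′) (cong₂ _++_ (arrows-sites (λ c → is c 1F) (λ c → is c 0F) z rs y d)
                                            (arrows-sites (λ c → is c 2F) (λ c → is c 2F) y (p′ ∷ q′ ∷ ps′) y c′))))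

    lemma : ∀ z y a b a′ b′ r r′ → T (joined (is z 2F) (is z 2F) a b) → T (joined (is y 2F) (is y 2F) a′ b′) →
            is r 0F ≡ is z 1F ⊎ not (is r′ 1F) ≡ is y 0F → verdict-z a b r ≢ z → verdict-y a′ b′ r′ ≢ y → ⊥
    lemma z y a b a′ b′ r r′ j j′ (inj₁ p) w _ = go z a b r j p w
      where
      go : ∀ z a b r → T (joined (is z 2F) (is z 2F) a b) → is r 0F ≡ is z 1F → ¬ (verdict-z a b r ≢ z)
      go = from-yes (every? λ z → every? λ a → every? λ b → every? λ r → Bool.T? (joined (is z 2F) (is z 2F) a b) →-dec
        ((is r 0F Bool.≟ is z 1F) →-dec ¬? (¬? (verdict-z a b r ≟ z))))
    lemma z y a b a′ b′ r r′ j j′ (inj₂ p) _ w = go y a′ b′ r′ j′ p w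
      where
      go : ∀ y a b r → T (joined (is y 2F) (is y 2F) a b) → not (is r 1F) ≡ is y 0F → ¬ (verdict-y a b r ≢ y)
      go = from-yes (every? λ y → every? λ a → every? λ b → every? λ r → Bool.T? (joined (is y 2F) (is y 2F) a b) →-dec
        ((not (is r 1F) Bool.≟ is y 0F) →-dec ¬? (¬? (verdict-y a b r ≟ y))))

  -- Only the first path may be short: `joined` is applied to the other two, while `hook` copes with
  -- one inner vertex and `relabel` with none.
  long-theta : ∀ z y ps p₂ q₂ ps₂ p₃ q₃ ps₃ →
    Chain z ps y → Chain y (p₂ ∷ q₂ ∷ ps₂) z → Chain z (p₃ ∷ q₃ ∷ ps₃) y →
    Unique (z ∷ y ∷ ps ++ (p₂ ∷ q₂ ∷ ps₂) ++ (p₃ ∷ q₃ ∷ ps₃)) → SagesWin G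
  long-theta z y ps p₂ q₂ ps₂ p₃ q₃ ps₃ c₁ c₂ c₃ u =
    plan-wins (ez ∷ ey ∷ es₁ ++ es₂ ++ es₃) (subst Unique (cong (λ vs → z ∷ y ∷ vs) (sym sites)) u) beats
    where
    es₁ es₂ es₃ : List Entry
    es₁ = route hook arrow (outward λ c → not (is c 1F)) z ps y c₁
    es₂ = arrows (λ c → is c 0F) (λ c → is c 0F) y (p₂ ∷ q₂ ∷ ps₂) z c₂
    es₃ = arrows (λ c → is c 2F) (λ c → is c 2F) z (p₃ ∷ q₃ ∷ ps₃) y c₃

    -- Along a bare edge `z` sees the colour of `y` itself; permuting it lets the same table serve.
    relabel : List V → Colour → Colour
    relabel []      = tab 1F 2F 0F
    relabel (_ ∷ _) = id

    ez ey : Entry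
    ez = record
      { at    = z
      ; say   = λ C → theta-z (relabel ps (C (firstOf ps y))) (C (lastOf q₂ ps₂)) (C p₃)
      ; local = λ C C′ eq → cong₂ _$_ (cong₂ theta-z (cong (relabel ps) (eq _ (chain-first ps c₁)))
                                      (eq _ (chain-last (p₂ ∷ q₂ ∷ ps₂) c₂))) (eq p₃ (proj₁ c₃))
      }
    ey = record
      { at    = y
      ; say   = λ C → theta-y (C (lastOf z ps)) (C p₂) (C (lastOf q₃ ps₃))
      ; local = λ C C′ eq → cong₂ _$_ (cong₂ theta-y (eq _ (chain-last ps c₁)) (eq p₂ (proj₁ c₂)))
                                      (eq _ (chain-last (p₃ ∷ q₃ ∷ ps₃) c₃))
      }

    sites : map at (es₁ ++ es₂ ++ es₃) ≡ ps ++ (p₂ ∷ q₂ ∷ ps₂) ++ (p₃ ∷ q₃ ∷ ps₃)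
    sites = trans (map-++ at es₁ (es₂ ++ es₃)) (cong₂ _++_ (route-sites hook arrow (outward λ c → not (is c 1F)) z ps y c₁)
      (trans (map-++ at es₂ es₃) (cong₂ _++_ (arrows-sites (λ c → is c 0F) (λ c → is c 0F) y (p₂ ∷ q₂ ∷ ps₂) z c₂)
                                             (arrows-sites (λ c → is c 2F) (λ c → is c 2F) z (p₃ ∷ q₃ ∷ ps₃) y c₃))))

    hub : ∀ qs (d : Chain z qs y) C → All (Wrong C) (route hook arrow (outward λ c → not (is c 1F)) z qs y d) →
      ∀ a₂ b₂ a₃ b₃ →
      T (joined (is (C y) 0F) (is (C z) 0F) b₂ a₂) → T (joined (is (C z) 2F) (is (C y) 2F) a₃ b₃) →
      theta-z (relabel qs (C (firstOf qs y))) a₂ a₃ ≢ C z → theta-y (C (lastOf z qs)) b₂ b₃ ≢ C y → ⊥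
    hub []       d C ws a₂ b₂ a₃ b₃ = theta-edge (C z) (C y) a₂ b₂ a₃ b₃
    hub (q ∷ qs) d C ws a₂ b₂ a₃ b₃ j₂ j₃ w w′ =
      theta-path (C z) (C y) (C q) (C (lastOf q qs)) (hooks-hooked (λ c → not (is c 1F)) C z q qs y d ws) a₂ b₂ j₂ a₃ b₃ j₃ w w′

    beats : ∀ C → ¬ All (Wrong C) (ez ∷ ey ∷ es₁ ++ es₂ ++ es₃)
    beats C (w ∷ w′ ∷ ws) = hub ps c₁ C (All.++⁻ˡ es₁ ws) _ _ _ _
      (arrows-joined (λ c → is c 0F) (λ c → is c 0F) C y p₂ q₂ ps₂ z c₂ (All.++⁻ˡ es₂ (All.++⁻ʳ es₁ ws)))
      (arrows-joined (λ c → is c 2F) (λ c → is c 2F) C z p₃ q₃ ps₃ y c₃ (All.++⁻ʳ es₂ (All.++⁻ʳ es₁ ws))) w w′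

  levels-cycle : ∀ z p ps → Chain z (p ∷ ps) z → Unique (z ∷ p ∷ ps) → 3 ∣ 2 + length ps → SagesWin G
  levels-cycle z p ps c u 3∣ =
    plan-wins (e ∷ es) (subst Unique (cong (z ∷_) (sym (route-sites climb climb (_⊕ 1F) z (p ∷ ps) z c))) u) λ { C (w ∷ ws) →
      descent-end (mod₃ (suc (length ps))) (C z) (C p) (C (lastOf p ps)) (3∣⇒mod₃≡0 _ 3∣)
        (route-invariant (λ k → Descent (mod₃ (suc k)) (C z) (C p)) (λ k → descent-step (mod₃ (suc k)) (C z) (C p))
          C 0 climb (_⊕ 1F) z p ps z c (descent-start (C z) (C p)) ws) w }
    where
    es : List Entry
    es = route climb climb (_⊕ 1F) z (p ∷ ps) z c

    e : Entry
    e = record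
      { at    = z
      ; say   = λ C → climb (C (lastOf p ps) ⊕ 2F) (C p)
      ; local = λ C C′ eq → cong₂ (λ b a → climb (b ⊕ 2F) a) (eq _ (chain-last (p ∷ ps) c)) (eq p (proj₁ c))
      }

  -- Each guess is right when a linear form vanishes. With s = x₀ + x₁ + x₃ and t = x₁ + x₂ - x₃ the
  -- four forms are, up to sign, s, t, s + t and t - s, and modulo 3 one of these is always 0.
  four-cycle : ∀ z p q r → Chain z (p ∷ q ∷ r ∷ []) z → Unique (z ∷ p ∷ q ∷ r ∷ []) → SagesWin G
  four-cycle z p q r (zp , pq , qr , rz) u =
    plan-wins (two z zp (Adj-sym rz) (λ b a → ⊖ a ⊕ ⊖ b) ∷ two p (Adj-sym zp) pq _⊕_ ∷
               two q (Adj-sym pq) qr (λ a b → b ⊕ ⊖ a) ∷ two r (Adj-sym qr) rz (λ a b → b ⊕ ⊖ a) ∷ []) u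
      λ { C (w₀ ∷ w₁ ∷ w₂ ∷ w₃ ∷ []) → lemma (C z) (C p) (C q) (C r) w₀ w₁ w₂ w₃ }
    where
    two : ∀ v {a b} → Adj G v a → Adj G v b → Rule → Entry
    two v {a} {b} va vb g = record
      { at = v ; say = λ C → g (C a) (C b) ; local = λ C C′ eq → cong₂ g (eq a va) (eq b vb) }

    lemma : ∀ x₀ x₁ x₂ x₃ → ⊖ x₃ ⊕ ⊖ x₁ ≢ x₀ → x₀ ⊕ x₂ ≢ x₁ → x₃ ⊕ ⊖ x₁ ≢ x₂ → x₀ ⊕ ⊖ x₂ ≢ x₃ → ⊥
    lemma = from-yes (every? λ x₀ → every? λ x₁ → every? λ x₂ → every? λ x₃ → ¬? (⊖ x₃ ⊕ ⊖ x₁ ≟ x₀) →-dec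
      (¬? (x₀ ⊕ x₂ ≟ x₁) →-dec (¬? (x₃ ⊕ ⊖ x₁ ≟ x₂) →-dec ¬? (¬? (x₀ ⊕ ⊖ x₂ ≟ x₃)))))

-- Graphs with two cycles

module Bicyclic (G : Graph) where

  open Plans G

  _∈?_ : (v : V) (xs : List V) → Dec (v ∈ xs)
  v ∈? xs = Any.any? (v ≟_) xs

  Adj-irrefl : ∀ {v} → ¬ Adj G v v
  Adj-irrefl {v} p = case trans (sym p) (Graph.irrefl G v) of λ ()

  unique-++ʳ : ∀ xs {ys : List V} → Unique (xs ++ ys) → Unique ys
  unique-++ʳ []       u       = u
  unique-++ʳ (x ∷ xs) (_ ∷ u) = unique-++ʳ xs u

  unique-++⇒disjoint : ∀ xs {ys} {v : V} → Unique (xs ++ ys) → v ∈ xs → v ∈ ys → ⊥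
  unique-++⇒disjoint (x ∷ xs) (x∉ ∷ u) (here refl) q = All.lookup x∉ (∈-++⁺ʳ xs q) refl
  unique-++⇒disjoint (x ∷ xs) (x∉ ∷ u) (there p)   q = unique-++⇒disjoint xs u p q

  theta-long : ∀ z y ps qs rs → 2 ≤ length qs → 2 ≤ length rs →
    Chain z ps y → Chain z qs y → Chain z rs y → Unique (z ∷ y ∷ ps ++ qs ++ rs) → SagesWin G
  theta-long z y ps qs rs 2≤qs 2≤rs c d e u =
    go (reverse qs) rs (ℕ.≤-trans 2≤qs (ℕ.≤-reflexive (sym (length-reverse qs)))) 2≤rs (chain-reverse qs d) e
       (Unique-↭ (prep z (prep y (↭.++⁺ˡ ps (↭.++⁺ʳ rs (↭-sym (↭.↭-reverse qs)))))) u)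
    where
    go : ∀ qs rs → 2 ≤ length qs → 2 ≤ length rs → Chain y qs z → Chain z rs y →
         Unique (z ∷ y ∷ ps ++ qs ++ rs) → SagesWin G
    go (q ∷ q′ ∷ qs) (r ∷ r′ ∷ rs) _ _ d e u = long-theta z y ps q q′ qs r r′ rs c d e u
    go (_ ∷ []) _ (s≤s ()) _ _ _ _
    go (_ ∷ _ ∷ _) (_ ∷ []) _ (s≤s ()) _ _ _

  theta-short : ∀ z y ps qs → ¬ 2 ≤ length ps → ¬ 2 ≤ length qs → ¬ (ps ≡ [] × qs ≡ []) →
    Chain z ps y → Chain z qs y → Unique (z ∷ y ∷ ps ++ qs) → SagesWin G
  theta-short z y []           []           _ _ ne _ _ _ = ⊥-elim (ne (refl , refl))
  theta-short z y []           (q ∷ [])     _ _ _ zy (zq , qy) u =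
    levels-cycle z q (y ∷ []) (zq , qy , Adj-sym zy) (Unique-↭ (prep z (swap y q ↭-refl)) u) (divides 1 refl)
  theta-short z y (p ∷ [])     []           _ _ _ (zp , py) zy u =
    levels-cycle z p (y ∷ []) (zp , py , Adj-sym zy) (Unique-↭ (prep z (swap y p ↭-refl)) u) (divides 1 refl)
  theta-short z y (p ∷ [])     (q ∷ [])     _ _ _ (zp , py) (zq , qy) u =
    four-cycle z p y q (zp , py , Adj-sym qy , Adj-sym zq) (Unique-↭ (prep z (swap y p ↭-refl)) u)
  theta-short z y (_ ∷ _ ∷ _) _             l _ _ _ _ _ = ⊥-elim (l (s≤s (s≤s z≤n)))
  theta-short z y []           (_ ∷ _ ∷ _)  _ l _ _ _ _ = ⊥-elim (l (s≤s (s≤s z≤n)))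
  theta-short z y (_ ∷ [])     (_ ∷ _ ∷ _)  _ l _ _ _ _ = ⊥-elim (l (s≤s (s≤s z≤n)))

  ++-rotate : ∀ (ps qs rs : List V) → ps ++ qs ++ rs ↭ rs ++ ps ++ qs
  ++-rotate ps qs rs = ↭-trans (↭-reflexive (sym (++-assoc ps qs rs))) (↭.++-comm (ps ++ qs) rs)

  -- Either two paths have at least two inner vertices each, or two shorter ones form a cycle of
  -- length 3 or 4, which wins by itself.
  theta : ∀ z y ps qs rs → ¬ (ps ≡ [] × qs ≡ []) → ¬ (ps ≡ [] × rs ≡ []) → ¬ (qs ≡ [] × rs ≡ []) →
    Chain z ps y → Chain z qs y → Chain z rs y → Unique (z ∷ y ∷ ps ++ qs ++ rs) → SagesWin G
  theta z y ps qs rs ¬pq ¬pr ¬qr c d e u with 2 ℕ.≤? length ps | 2 ℕ.≤? length qs | 2 ℕ.≤? length rs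
  ... | _      | yes lq | yes lr = theta-long z y ps qs rs lq lr c d e u
  ... | yes lp | no  _  | yes lr = theta-long z y qs ps rs lp lr d c e (Unique-↭ (prep z (prep y (↭.shifts ps qs))) u)
  ... | yes lp | yes lq | no  _  = theta-long z y rs ps qs lp lq e c d (Unique-↭ (prep z (prep y (++-rotate ps qs rs))) u)
  ... | _      | no  sq | no  sr = theta-short z y qs rs sq sr ¬qr d e (unique-++ʳ ps (Unique-↭ (↭.shifts (z ∷ y ∷ []) ps) u))
  ... | no  sp | no  sq | yes _  = theta-short z y ps qs sp sq ¬pq c d
    (unique-++ʳ rs (Unique-↭ (↭-trans (prep z (prep y (++-rotate ps qs rs))) (↭.shifts (z ∷ y ∷ []) rs)) u))
  ... | no  sp | yes _  | no  sr = theta-short z y ps rs sp sr ¬pr c e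
    (unique-++ʳ qs (Unique-↭ (↭-trans (prep z (prep y (↭.shifts ps qs))) (↭.shifts (z ∷ y ∷ []) qs)) u))

  record Ring (z : V) (ps : List V) : Set where
    constructor ring
    field
      chain    : Chain z ps z
      distinct : Unique (z ∷ ps)
      long     : 2 ≤ length ps

  open Ring public

  turn-ring : ∀ {z} xs {u} ys → Ring z (xs ++ u ∷ ys) → Ring u (ys ++ z ∷ xs)
  turn-ring {z} xs {u} ys (ring c d l) = let (c₁ , c₂) = chain-++⁻ xs ys c in
    ring (chain-++ ys xs c₂ c₁) (Unique-↭ turn d) (ℕ.≤-trans l (ℕ.≤-reflexive (ℕ.suc-injective (↭.↭-length turn))))
    where
    turn : z ∷ xs ++ u ∷ ys ↭ u ∷ ys ++ z ∷ xs
    turn = ↭.++-comm (z ∷ xs) (u ∷ ys)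

  rotate-ring : ∀ {z ps u} → Ring z ps → u ∈ z ∷ ps → ∃ λ qs → Ring u qs × z ∷ ps ↭ u ∷ qs
  rotate-ring {ps = ps} r (here refl) = ps , r , ↭-refl
  rotate-ring {z} {ps} {u} r (there p) with ∈-∃++ p
  ... | xs , ys , refl = ys ++ z ∷ xs , turn-ring xs ys r , ↭.++-comm (z ∷ xs) (u ∷ ys)

  reverse-[] : ∀ (bs : List V) → reverse bs ≡ [] → bs ≡ []
  reverse-[] []       _ = refl
  reverse-[] (b ∷ bs) q = case trans (sym (length-reverse (b ∷ bs))) (cong length q) of λ ()

  ring-ear : ∀ u as v bs qs → Ring u (as ++ v ∷ bs) → Chain u qs v → Unique (u ∷ (as ++ v ∷ bs) ++ qs) →
    ¬ (qs ≡ [] × as ≡ []) → ¬ (qs ≡ [] × bs ≡ []) → SagesWin G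
  ring-ear u as v bs qs (ring c _ l) d un ¬qa ¬qb with chain-++⁻ as bs c
  ... | c₁ , c₂ = theta u v qs as (reverse bs) ¬qa (λ { (p , q) → ¬qb (p , reverse-[] bs q) }) ¬ab d c₁ (chain-reverse bs c₂)
    (Unique-↭ (prep u shuffle) un)
    where
    ¬ab : ¬ (as ≡ [] × reverse bs ≡ [])
    ¬ab (refl , q) with reverse-[] bs q
    ... | refl = case l of λ { (s≤s ()) }

    shuffle : (as ++ v ∷ bs) ++ qs ↭ v ∷ qs ++ as ++ reverse bs
    shuffle = ↭-trans (↭.++⁺ʳ qs (↭.shift v as bs)) (prep v (↭-trans (↭.++-comm (as ++ bs) qs)
      (↭.++⁺ˡ qs (↭.++⁺ˡ as (↭-sym (↭.↭-reverse bs))))))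

  ring-loop : ∀ u ps qs → Ring u ps → Chain u qs u → 2 ≤ length qs → Unique (u ∷ ps ++ qs) → SagesWin G
  ring-loop u (p ∷ p′ ∷ ps) (q ∷ q′ ∷ qs) (ring c _ _) d _ un = figure-eight u p p′ ps q q′ qs c d un
  ring-loop u (_ ∷ []) _ (ring _ _ (s≤s ())) _ _ _
  ring-loop u (_ ∷ _ ∷ _) (_ ∷ []) _ _ (s≤s ()) _

  ring-dumbbell : ∀ u ps rs y qs → Ring u ps → Chain u rs y → Ring y qs →
    Unique (u ∷ y ∷ ps ++ rs ++ qs) → SagesWin G
  ring-dumbbell u (p ∷ p′ ∷ ps) rs y (q ∷ q′ ∷ qs) (ring c _ _) d (ring e _ _) un =
    dumbbell u p p′ ps rs y q q′ qs c d e un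
  ring-dumbbell u (_ ∷ []) _ _ _ (ring _ _ (s≤s ())) _ _ _
  ring-dumbbell u (_ ∷ _ ∷ _) _ _ (_ ∷ []) _ _ (ring _ _ (s≤s ())) _

  -- Loop erasure from the far end: if `u` recurs on the simple remainder, the chain restarts at
  -- that occurrence.
  erase : ∀ {u} rs {y} → u ≢ y → Chain u rs y →
    ∃ λ rs′ → Chain u rs′ y × Unique (u ∷ rs′ ++ [ y ]) × (∀ {P : V → Set} → All P rs → All P rs′)
  erase {u} [] {y} u≢y c = [] , c , (u≢y ∷ []) ∷ ([] ∷ []) , id
  erase {u} (x ∷ rs) {y} u≢y (a , c) with x ≟ y
  ... | yes refl = [] , a , (u≢y ∷ []) ∷ ([] ∷ []) , λ _ → []
  ... | no x≢y with erase rs x≢y c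
  ... | rs′ , c′ , un , sub with u ∈? (x ∷ rs′)
  ...   | no u∉ = x ∷ rs′ , (a , c′) , All.++⁺ (All.¬Any⇒All¬ (x ∷ rs′) u∉) (u≢y ∷ []) ∷ un , λ { (p ∷ ps) → p ∷ sub ps }
  ...   | yes (here refl) = rs′ , c′ , un , λ { (_ ∷ ps) → sub ps }
  ...   | yes (there u∈) with ∈-∃++ u∈
  ...     | as , bs , refl = bs , proj₂ (chain-++⁻ as bs c′) ,
    unique-++ʳ (x ∷ as) (subst Unique (cong (x ∷_) (++-assoc as (u ∷ bs) [ y ])) un) ,
    λ { (_ ∷ ps) → All.tail (All.++⁻ʳ as (sub ps)) }

  Outside : List V → V → Set
  Outside L v = v ∉ L

  -- Supplies an ear: a closed chain that does not stay in `L` leaves it somewhere, and its first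
  -- stretch outside ends on the return.
  excursion : ∀ L u ws t → u ∈ L → t ∈ L → Chain u ws t → ¬ All (_∈ L) ws →
    ∃ λ xs → ∃₂ λ q qs → ∃ λ ys → ws ≡ xs ++ (q ∷ qs) ++ ys × All (Outside L) (q ∷ qs) ×
      lastOf u xs ∈ L × firstOf ys t ∈ L × Chain (lastOf u xs) (q ∷ qs) (firstOf ys t)
  excursion L u [] t u∈ t∈ c ¬all = ⊥-elim (¬all [])
  excursion L u (x ∷ ws) t u∈ t∈ (a , c) ¬all with x ∈? L
  ... | yes x∈ = let (xs , q , qs , ys , eq , out , l∈ , f∈ , d) = excursion L x ws t x∈ t∈ c (¬all ∘ (x∈ ∷_)) in
    x ∷ xs , q , qs , ys , cong (x ∷_) eq , out , l∈ , f∈ , d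
  ... | no x∉ = let (qs , ys , eq , out , f∈ , d) = prefix ws c in
    [] , x , qs , ys , cong (x ∷_) eq , x∉ ∷ out , u∈ , f∈ , (a , d)
    where
    prefix : ∀ {x} ws → Chain x ws t →
      ∃₂ λ qs ys → ws ≡ qs ++ ys × All (Outside L) qs × firstOf ys t ∈ L × Chain x qs (firstOf ys t)
    prefix []       c       = [] , [] , refl , [] , t∈ , c
    prefix (w ∷ ws) (b , c) with w ∈? L
    ... | yes w∈ = [] , w ∷ ws , refl , [] , w∈ , b
    ... | no w∉  = let (qs , ys , eq , out , f∈ , d) = prefix ws c in
      w ∷ qs , ys , cong (w ∷_) eq , w∉ ∷ out , f∈ , (b , d)

  lastOf-∈ : ∀ x xs → lastOf x xs ∈ x ∷ xs
  lastOf-∈ x []       = here refl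
  lastOf-∈ x (y ∷ xs) = there (lastOf-∈ y xs)

  -- Equal ends give two rings with one common vertex, distinct ends a theta graph.
  ear-wins : ∀ {z ps} → Ring z ps → ∀ u q qs v → u ∈ z ∷ ps → v ∈ z ∷ ps → Chain u (q ∷ qs) v →
    Unique (q ∷ qs) → All (Outside (z ∷ ps)) (q ∷ qs) → (u ≡ v → 2 ≤ length (q ∷ qs)) → SagesWin G
  ear-wins {z} {ps} r u q qs v u∈ v∈ c uq out loop with rotate-ring r u∈
  ... | cs , r′ , turn = go (↭.∈-resp-↭ turn v∈)
    where
    un : Unique (u ∷ cs ++ q ∷ qs)
    un = Unique.++⁺ (distinct r′) uq λ { (i , j) → All.lookup out j (↭.∈-resp-↭ (↭-sym turn) i) }

    go : v ∈ u ∷ cs → SagesWin G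
    go (here refl) = ring-loop u cs (q ∷ qs) r′ c (loop refl) un
    go (there v∈cs) with ∈-∃++ v∈cs
    ... | as , bs , refl = ring-ear u as v bs (q ∷ qs) r′ c un (λ { (() , _) }) (λ { (() , _) })

  meeting-rings : ∀ {z ps u ws} → Ring z ps → Ring u ws → u ∈ z ∷ ps → ¬ All (_∈ z ∷ ps) ws → SagesWin G
  meeting-rings {z} {ps} {u} {ws} r s u∈ ¬all with excursion (z ∷ ps) u ws u u∈ u∈ (chain s) ¬all
  ... | xs , q , qs , ys , refl , out , l∈ , f∈ , c =
    ear-wins r (lastOf u xs) q qs (firstOf ys u) l∈ f∈ c
      (unique-++ʳ ys (Unique-↭ (↭.++-comm (q ∷ qs) ys) (unique-++ʳ xs (unique-++ʳ [ u ] (distinct s)))))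
      out (loop xs ys (distinct s) (long s))
    where
    -- If the ear returns to where it left, distinctness empties `xs` and `ys`, so the ear is the
    -- whole second ring without its base.
    loop : ∀ xs ys → Unique (u ∷ xs ++ (q ∷ qs) ++ ys) → 2 ≤ length (xs ++ (q ∷ qs) ++ ys) →
           lastOf u xs ≡ firstOf ys u → 2 ≤ length (q ∷ qs)
    loop [] [] un l eq = ℕ.≤-trans l (ℕ.≤-reflexive (cong length (++-identityʳ (q ∷ qs))))
    loop [] (y ∷ ys) un l refl = ⊥-elim (unique-++⇒disjoint [ u ] un (here refl) (∈-++⁺ʳ (q ∷ qs) (here refl)))
    loop (x ∷ xs) [] un l eq = ⊥-elim (unique-++⇒disjoint [ u ] un (here refl)
      (∈-++⁺ˡ (subst (_∈ x ∷ xs) eq (lastOf-∈ x xs))))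
    loop (x ∷ xs) (y ∷ ys) un l eq = ⊥-elim (unique-++⇒disjoint (x ∷ xs) (unique-++ʳ [ u ] un) (lastOf-∈ x xs)
      (subst (_∈ (q ∷ qs) ++ y ∷ ys) (sym eq) (∈-++⁺ʳ (q ∷ qs) (here refl))))

  walk-chain : ∀ {u v} → Walk G u v → u ≡ v ⊎ ∃ λ ps → Chain u ps v
  walk-chain here = inj₁ refl
  walk-chain (step {v = w} a ω) with walk-chain ω
  ... | inj₁ refl     = inj₂ ([] , a)
  ... | inj₂ (ps , c) = inj₂ (w ∷ ps , a , c)

  Bridge : List V → List V → V → Set
  Bridge L M u = ∃₂ λ rs y → Chain u rs y × y ∈ M × All (Outside L) rs × All (Outside M) rs

  -- Working back from the far end, a vertex extends the bridge unless it lies on `L`, where the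
  -- bridge starts for good, or on `M`, where a shorter one ends.
  bridge : ∀ L M u ps t → t ∈ M → Chain u ps t → Bridge L M u ⊎ ∃ λ u′ → u′ ∈ L × Bridge L M u′
  bridge L M u [] t t∈ c = inj₁ ([] , t , c , t∈ , [] , [])
  bridge L M u (x ∷ ps) t t∈ (a , c) with bridge L M x ps t t∈ c
  ... | inj₂ found = inj₂ found
  ... | inj₁ (rs , y , d , y∈ , oL , oM) with x ∈? L | x ∈? M
  ...   | yes x∈ | _      = inj₂ (x , x∈ , rs , y , d , y∈ , oL , oM)
  ...   | no  _  | yes x∈ = inj₁ ([] , x , a , x∈ , [] , [])
  ...   | no x∉L | no x∉M = inj₁ (x ∷ rs , y , (a , d) , y∈ , x∉L ∷ oL , x∉M ∷ oM)

  disjoint-rings : Connected G → ∀ {z ps u ws} → Ring z ps → Ring u ws →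
    (∀ {v} → v ∈ z ∷ ps → v ∉ u ∷ ws) → SagesWin G
  disjoint-rings conn {z} {ps} {u} {ws} r s dis with walk-chain (conn z u)
  ... | inj₁ refl = ⊥-elim (dis (here refl) (here refl))
  ... | inj₂ (cs , c) = [ (λ b → cross z (here refl) b) , (λ { (x , x∈ , b) → cross x x∈ b }) ]′
                          (bridge (z ∷ ps) (u ∷ ws) z cs u (here refl) c)
    where
    cross : ∀ x → x ∈ z ∷ ps → Bridge (z ∷ ps) (u ∷ ws) x → SagesWin G
    cross x x∈ (rs , y , d , y∈ , oL , oM) with erase rs (λ { refl → dis x∈ y∈ }) d
    ... | rs′ , d′ , un , sub with rotate-ring r x∈ | rotate-ring s y∈
    ... | cs , r′ , turn | ds , s′ , turn′ = ring-dumbbell x cs rs′ y ds r′ d′ s′ (Unique-↭ shuffle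
        (Unique.++⁺ (distinct r′) (Unique.++⁺ (distinct s′) (unique-init x rs′ un) dis₁) dis₂))
      where
      unique-init : ∀ x rs → Unique (x ∷ rs ++ [ y ]) → Unique rs
      unique-init x rs un = unique-++ʳ [ y ] (Unique-↭ (↭.++-comm rs [ y ]) (unique-++ʳ [ x ] un))

      dis₁ : ∀ {v} → v ∈ y ∷ ds × v ∈ rs′ → ⊥
      dis₁ (i , j) = All.lookup (sub oM) j (↭.∈-resp-↭ (↭-sym turn′) i)

      dis₂ : ∀ {v} → v ∈ x ∷ cs × v ∈ (y ∷ ds) ++ rs′ → ⊥
      dis₂ (i , j) with ∈-++⁻ (y ∷ ds) j
      ... | inj₁ k = dis (↭.∈-resp-↭ (↭-sym turn) i) (↭.∈-resp-↭ (↭-sym turn′) k)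
      ... | inj₂ k = All.lookup (sub oL) k (↭.∈-resp-↭ (↭-sym turn) i)

      shuffle : (x ∷ cs) ++ (y ∷ ds) ++ rs′ ↭ x ∷ y ∷ cs ++ rs′ ++ ds
      shuffle = prep x (↭-trans (↭.shift y cs (ds ++ rs′)) (prep y (↭.++⁺ˡ cs (↭.++-comm ds rs′))))

-- Cycles as rings, their chords, and the search for a cycle

module Cycles (G : Graph) where

  open Plans G
  open Bicyclic G

  CycleEdge-sym : ∀ (c : Cycle G) {u v} → CycleEdge c u v → CycleEdge c v u
  CycleEdge-sym c (inj₁ (i , inj₁ e)) = inj₁ (i , inj₂ e)
  CycleEdge-sym c (inj₁ (i , inj₂ e)) = inj₁ (i , inj₁ e)
  CycleEdge-sym c (inj₂ (inj₁ e))     = inj₂ (inj₂ e)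
  CycleEdge-sym c (inj₂ (inj₂ e))     = inj₂ (inj₁ e)

  CycleEdge? : ∀ (c : Cycle G) u v → Dec (CycleEdge c u v)
  CycleEdge? c u v =
    any? (λ i → ((vs c (inject₁ i) ≟ u) ×-dec (vs c (suc i) ≟ v)) ⊎-dec ((vs c (inject₁ i) ≟ v) ×-dec (vs c (suc i) ≟ u)))
    ⊎-dec (((vs c (fromℕ (m c)) ≟ u) ×-dec (vs c zero ≟ v)) ⊎-dec ((vs c (fromℕ (m c)) ≟ v) ×-dec (vs c zero ≟ u)))

  CycleEdge⇒Adj : ∀ (c : Cycle G) {u v} → CycleEdge c u v → Adj G u v
  CycleEdge⇒Adj c (inj₁ (i , inj₁ (refl , refl))) = consec c i
  CycleEdge⇒Adj c (inj₁ (i , inj₂ (refl , refl))) = Adj-sym (consec c i)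
  CycleEdge⇒Adj c (inj₂ (inj₁ (refl , refl)))     = closing c
  CycleEdge⇒Adj c (inj₂ (inj₂ (refl , refl)))     = Adj-sym (closing c)

  vertices : Cycle G → List V
  vertices c = tabulate (vs c)

  CycleEdge⇒∈ : ∀ (c : Cycle G) {u v} → CycleEdge c u v → u ∈ vertices c
  CycleEdge⇒∈ c (inj₁ (i , inj₁ (refl , _))) = ∈-tabulate⁺ {f = vs c} (inject₁ i)
  CycleEdge⇒∈ c (inj₁ (i , inj₂ (_ , refl))) = ∈-tabulate⁺ {f = vs c} (suc i)
  CycleEdge⇒∈ c (inj₂ (inj₁ (refl , _)))     = ∈-tabulate⁺ {f = vs c} (fromℕ (m c))
  CycleEdge⇒∈ c (inj₂ (inj₂ (_ , refl)))     = ∈-tabulate⁺ {f = vs c} zero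

  tabulate-chain : ∀ k (f : Fin (suc k) → V) {w} → (∀ i → Adj G (f (inject₁ i)) (f (suc i))) →
    Adj G (f (fromℕ k)) w → Chain (f zero) (tabulate (f ∘ suc)) w
  tabulate-chain zero    f adj last = last
  tabulate-chain (suc k) f adj last = adj zero , tabulate-chain k (f ∘ suc) (adj ∘ suc) last

  cycle-ring : (c : Cycle G) → Ring (vs c zero) (tabulate (vs c ∘ suc))
  cycle-ring c = ring (tabulate-chain (m c) (vs c) (consec c) (closing c)) (Unique.tabulate⁺ (inj c))
    (ℕ.≤-trans (m≥2 c) (ℕ.≤-reflexive (sym (length-tabulate (vs c ∘ suc)))))

  lookup-injective : ∀ {xs : List V} → Unique xs → ∀ {i j} → lookup xs i ≡ lookup xs j → i ≡ j
  lookup-injective {x ∷ xs} (x∉ ∷ u) {zero}  {zero}  eq = refl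
  lookup-injective {x ∷ xs} (x∉ ∷ u) {zero}  {suc j} eq = ⊥-elim (All.lookup x∉ (∈-lookup j) eq)
  lookup-injective {x ∷ xs} (x∉ ∷ u) {suc i} {zero}  eq = ⊥-elim (All.lookup x∉ (∈-lookup i) (sym eq))
  lookup-injective {x ∷ xs} (x∉ ∷ u) {suc i} {suc j} eq = cong suc (lookup-injective u eq)

  chain-consec : ∀ z ps {w} → Chain z ps w → ∀ i → Adj G (lookup (z ∷ ps) (inject₁ i)) (lookup (z ∷ ps) (suc i))
  chain-consec z (p ∷ ps) (a , c) zero    = a
  chain-consec z (p ∷ ps) (a , c) (suc i) = chain-consec p ps c i

  lookup-last : ∀ z ps → lookup (z ∷ ps) (fromℕ (length ps)) ≡ lastOf z ps
  lookup-last z []       = refl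
  lookup-last z (p ∷ ps) = lookup-last p ps

  ring-cycle : ∀ {z ps} → Ring z ps → Cycle G
  ring-cycle {z} {ps} r = record
    { m       = length ps
    ; m≥2     = long r
    ; vs      = lookup (z ∷ ps)
    ; inj     = lookup-injective (distinct r)
    ; consec  = chain-consec z ps (chain r)
    ; closing = subst (λ v → Adj G v z) (sym (lookup-last z ps)) (Adj-sym (chain-last ps (chain r)))
    }

  consecutive-edge : ∀ k (f : Fin (suc k) → V) xs {u v ws} → tabulate f ≡ xs ++ u ∷ v ∷ ws →
    ∃ λ (i : Fin k) → f (inject₁ i) ≡ u × f (suc i) ≡ v
  consecutive-edge zero    f []            ()
  consecutive-edge zero    f (x ∷ [])      ()
  consecutive-edge zero    f (x ∷ x′ ∷ xs) ()
  consecutive-edge (suc k) f []            refl = zero , refl , refl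
  consecutive-edge (suc k) f (x ∷ xs)      eq   =
    let (i , p , q) = consecutive-edge k (f ∘ suc) xs (proj₂ (∷-injective eq)) in suc i , p , q

  lastOf-tabulate : ∀ k (f : Fin (suc k) → V) → lastOf (f zero) (tabulate (f ∘ suc)) ≡ f (fromℕ k)
  lastOf-tabulate zero    f = refl
  lastOf-tabulate (suc k) f = lastOf-tabulate k (f ∘ suc)

  lastOf-++ : ∀ x as v → lastOf x (as ++ [ v ]) ≡ v
  lastOf-++ x []       v = refl
  lastOf-++ x (a ∷ as) v = lastOf-++ a as v

  Chord : Cycle G → V → V → Set
  Chord c u v = ∃₂ λ xs as → ∃ λ ws → vertices c ≡ xs ++ u ∷ as ++ v ∷ ws × as ≢ [] × ¬ (xs ≡ [] × ws ≡ [])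

  chord : ∀ (c : Cycle G) {u v} → ¬ CycleEdge c u v → ∀ xs as ws → vertices c ≡ xs ++ u ∷ as ++ v ∷ ws → Chord c u v
  chord c {u} {v} ¬e xs as ws eq = xs , as , ws , eq , inner as eq , outer
    where
    inner : ∀ as → vertices c ≡ xs ++ u ∷ as ++ v ∷ ws → as ≢ []
    inner .[] eq refl = let (i , p , q) = consecutive-edge (m c) (vs c) xs eq in ¬e (inj₁ (i , inj₁ (p , q)))
    outer : ¬ (xs ≡ [] × ws ≡ [])
    outer (refl , refl) = let (p , q) = ∷-injective eq in
      ¬e (inj₂ (inj₂ (trans (sym (lastOf-tabulate (m c) (vs c)))
                        (trans (cong (lastOf (vs c zero)) q) (lastOf-++ (vs c zero) as v)) , p)))

  chords : ∀ (c : Cycle G) {u v} → u ≢ v → u ∈ vertices c → v ∈ vertices c → ¬ CycleEdge c u v →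
    Chord c u v ⊎ Chord c v u
  chords c {u} {v} u≢v u∈ v∈ ¬e with ∈-∃++ u∈
  ... | xs , ys , eq with ∈-++⁻ xs (subst (v ∈_) eq v∈)
  ... | inj₂ (here refl) = ⊥-elim (u≢v refl)
  ... | inj₂ (there q) with ∈-∃++ q
  ...   | as , ws , refl = inj₁ (chord c ¬e xs as ws eq)
  chords c {u} {v} u≢v u∈ v∈ ¬e | xs , ys , eq | inj₁ q with ∈-∃++ q
  ...   | xs′ , as , refl = inj₂ (chord c (¬e ∘ CycleEdge-sym c) xs′ as ys (trans eq (++-assoc xs′ (v ∷ as) (u ∷ ys))))

  chord-ring : ∀ (c : Cycle G) {u v} → Chord c u v →
    ∃₂ λ as bs → as ≢ [] × bs ≢ [] × Ring u (as ++ v ∷ bs)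
  chord-ring c {u} {v} (xs , as , ws , eq , as≢[] , ¬ends) =
    let (bs , bs≢[] , r) = go (cycle-ring c) xs eq ¬ends in as , bs , as≢[] , bs≢[] , r
    where
    nonempty : ∀ ws {z : V} {xs} → ws ++ z ∷ xs ≢ []
    nonempty []      ()
    nonempty (_ ∷ _) ()

    go : ∀ {z ps} → Ring z ps → ∀ xs → z ∷ ps ≡ xs ++ u ∷ as ++ v ∷ ws → ¬ (xs ≡ [] × ws ≡ []) →
         ∃ λ bs → bs ≢ [] × Ring u (as ++ v ∷ bs)
    go r []       refl ¬ends = ws , (λ p → ¬ends (refl , p)) , r
    go r (z ∷ xs) refl ¬ends = ws ++ z ∷ xs , nonempty ws ,
      subst (Ring u) (++-assoc as (v ∷ ws) (z ∷ xs)) (turn-ring xs (as ++ v ∷ ws) r)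

  chord-wins : ∀ (c : Cycle G) {u v} → Adj G u v → Chord c u v → SagesWin G
  chord-wins c {u} {v} a ch with chord-ring c ch
  ... | as , bs , as≢[] , bs≢[] , r =
    ring-ear u as v bs [] r a (subst Unique (cong (u ∷_) (sym (++-identityʳ _))) (distinct r))
      (as≢[] ∘ proj₂) (bs≢[] ∘ proj₂)

  -- One arc closed by the chord is a cycle through the chord; this is what makes a unique cycle
  -- chordless.
  chord-cycle : ∀ (c : Cycle G) {u v} → Adj G u v → Chord c u v → ∃ λ c′ → CycleEdge c′ v u
  chord-cycle c {u} {v} a ch with chord-ring c ch
  ... | as , bs , as≢[] , _ , ring d un _ =
    ring-cycle (ring (chain-++ as [] (proj₁ (chain-++⁻ as bs d)) (Adj-sym a)) prefix (long′ as as≢[])) ,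
    inj₂ (inj₁ (trans (lookup-last u (as ++ [ v ])) (lastOf-++ u as v) , refl))
    where
    prefix : Unique (u ∷ as ++ [ v ])
    prefix = unique-++ʳ bs (Unique-↭ (↭.++-comm (u ∷ as ++ [ v ]) bs)
      (subst Unique (cong (u ∷_) (sym (++-assoc as [ v ] bs))) un))

    long′ : ∀ as → as ≢ [] → 2 ≤ length (as ++ [ v ])
    long′ []           ne = ⊥-elim (ne refl)
    long′ (_ ∷ [])     _  = s≤s (s≤s z≤n)
    long′ (_ ∷ _ ∷ as) _  = s≤s (s≤s z≤n)

  -- If `c′` stays on the vertices of `c`, its extra edge is a chord. If it misses them all, a path
  -- joins the two cycles. Otherwise it contains an ear of `c`.
  two-cycles-win : Connected G → ∀ (c c′ : Cycle G) {u v} → CycleEdge c′ u v → ¬ CycleEdge c u v → SagesWin G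
  two-cycles-win conn c c′ {u} {v} e ¬e with All.all? (_∈? vertices c) (vertices c′)
  ... | yes all = [ chord-wins c a , chord-wins c (Adj-sym a) ]′
    (chords c (λ { refl → Adj-irrefl a }) (All.lookup all (CycleEdge⇒∈ c′ e))
                                          (All.lookup all (CycleEdge⇒∈ c′ (CycleEdge-sym c′ e))) ¬e)
    where
    a : Adj G u v
    a = CycleEdge⇒Adj c′ e
  ... | no ¬all with Any.any? (_∈? vertices c) (vertices c′)
  ...   | no none = disjoint-rings conn (cycle-ring c) (cycle-ring c′) λ i j → none (lose j i)
  ...   | yes some with find some
  ...     | w , w∈c′ , w∈c with rotate-ring (cycle-ring c′) w∈c′
  ...       | ws , r , turn = meeting-rings (cycle-ring c) r w∈c λ all → ¬all (All.tabulate λ i →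
                All.lookup (w∈c ∷ all) (↭.∈-resp-↭ turn i))

  cycle-wins : ∀ (c : Cycle G) → 3 ∣ len c ⊎ len c ≡ 4 → SagesWin G
  cycle-wins c good = go (cycle-ring c) (length-tabulate (vs c ∘ suc)) good
    where
    go : ∀ {z ps k} → Ring z ps → length ps ≡ k → 3 ∣ suc k ⊎ suc k ≡ 4 → SagesWin G
    go {z} {p ∷ ps}              (ring c u _) refl (inj₁ 3∣)   = levels-cycle z p ps c u 3∣
    go {z} {p ∷ q ∷ r ∷ []}      (ring c u _) refl (inj₂ refl) = four-cycle z p q r c u

  any-vec? : ∀ k {P : Vec V k → Set} → (∀ xs → Dec (P xs)) → Dec (∃ P)
  any-vec? zero    P? = map′ (λ p → [] , p) (λ { ([] , p) → p }) (P? [])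
  any-vec? (suc k) P? = map′ (λ { (x , xs , p) → x ∷ xs , p }) (λ { (x ∷ xs , p) → x , xs , p })
    (any? λ x → any-vec? k λ xs → P? (x ∷ xs))

  -- Injectivity bounds the length by the number of vertices, and vectors in place of functions make
  -- the search finite.
  cycle? : Dec (Cycle G)
  cycle? = map′ to from (any? λ (k : Fin (Graph.n G)) → any-vec? (suc (toℕ k)) (valid? (toℕ k)))
    where
    Valid : ∀ k → Vec V (suc k) → Set
    Valid k xs = 2 ≤ k × (∀ i j → Vec.lookup xs i ≡ Vec.lookup xs j → i ≡ j) ×
      (∀ i → Adj G (Vec.lookup xs (inject₁ i)) (Vec.lookup xs (suc i))) × Adj G (Vec.lookup xs (fromℕ k)) (Vec.lookup xs zero)

    valid? : ∀ k xs → Dec (Valid k xs)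
    valid? k xs = (2 ℕ.≤? k) ×-dec (all? λ i → all? λ j → (Vec.lookup xs i ≟ Vec.lookup xs j) →-dec (i ≟ j)) ×-dec
      (all? λ i → adj G _ _ Bool.≟ true) ×-dec (adj G _ _ Bool.≟ true)

    to : ∃ (λ (k : Fin (Graph.n G)) → ∃ (Valid (toℕ k))) → Cycle G
    to (k , xs , 2≤k , i , a , z) = record
      { m = toℕ k ; m≥2 = 2≤k ; vs = Vec.lookup xs ; inj = i _ _ ; consec = a ; closing = z }

    from : Cycle G → ∃ λ (k : Fin (Graph.n G)) → ∃ (Valid (toℕ k))
    from c = fromℕ< bound , subst (λ k → ∃ (Valid k)) (sym (Fin.toℕ-fromℕ< bound)) (Vec.tabulate (vs c) ,
      m≥2 c , (λ i j eq → inj c (trans (sym (entry i)) (trans eq (entry j)))) ,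
      (λ i → subst₂ (Adj G) (sym (entry (inject₁ i))) (sym (entry (suc i))) (consec c i)) ,
      subst₂ (Adj G) (sym (entry (fromℕ (m c)))) (sym (entry zero)) (closing c))
      where
      entry : ∀ i → Vec.lookup (Vec.tabulate (vs c)) i ≡ vs c i
      entry = Vec.lookup∘tabulate (vs c)
      bound : m c < Graph.n G
      bound = Fin.injective⇒≤ (inj c)

-- Positions on a cycle

next : ∀ {k} → Fin (suc k) → Fin (suc k)
next i with view i
... | ‵fromℕ     = zero
... | ‵inject₁ i = suc i

next-fromℕ : ∀ k → next (fromℕ k) ≡ zero
next-fromℕ k rewrite view-fromℕ k = refl

next-inject₁ : ∀ {k} (i : Fin k) → next (inject₁ i) ≡ suc i
next-inject₁ i rewrite view-inject₁ i = refl

next-injective : ∀ {k} (i j : Fin (suc k)) → next i ≡ next j → i ≡ j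
next-injective i j eq with view i | view j
... | ‵fromℕ     | ‵fromℕ     = refl
next-injective _ _ refl | ‵inject₁ i | ‵inject₁ .i = refl

position : ∀ {k} → ℕ → Fin (suc k)
position zero    = zero
position (suc j) = next (position j)

position-toℕ : ∀ {k} j (i : Fin (suc k)) → toℕ i ≡ j → position j ≡ i
position-toℕ zero    zero    eq = refl
position-toℕ (suc j) (suc i) eq = trans
  (cong next (position-toℕ j (inject₁ i) (trans (Fin.toℕ-inject₁ i) (ℕ.suc-injective eq)))) (next-inject₁ i)

position-suc : ∀ k → position {k} (suc k) ≡ zero
position-suc k = trans (cong next (position-toℕ k (fromℕ k) (Fin.toℕ-fromℕ k))) (next-fromℕ k)

position-periodic : ∀ k j → position {k} (j + suc k) ≡ position j
position-periodic k zero    = position-suc k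
position-periodic k (suc j) = cong next (position-periodic k j)

toℕ-position : ∀ k j → j ≤ k → toℕ (position {k} j) ≡ j
toℕ-position k j j≤k = trans (cong toℕ (position-toℕ j (fromℕ< (s≤s j≤k)) (Fin.toℕ-fromℕ< (s≤s j≤k)))) (Fin.toℕ-fromℕ< (s≤s j≤k))

-- The type of a run shows only its end colours; a placement needs those in between as well.
run-colours : ∀ {f k a b c d} → Run f k a b c d → ∃ λ (x : ℕ → Colour) →
  (x 0 ≡ a × x 1 ≡ b) × (x k ≡ c × x (suc k) ≡ d) × (∀ j → j < k → f (suc j) (x j) (x (suc (suc j))) ≢ x (suc j))
run-colours ([] {a} {b}) = (λ { 0 → a ; (suc _) → b }) , (refl , refl) , (refl , refl) , λ j ()
run-colours {f} (_▹_ {k} {c = c} {d} {e} r w) with run-colours r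
... | x , (x₀ , x₁) , (xₖ , xₖ₊₁) , wrong =
  y , (trans (y-old 0 λ ()) x₀ , trans (y-old 1 λ ()) x₁) , (trans (y-old (suc k) λ ()) xₖ₊₁ , y-new) , wrong′
  where
  y : ℕ → Colour
  y j = if does (j ℕ.≟ suc (suc k)) then e else x j

  y-new : y (suc (suc k)) ≡ e
  y-new = cong (if_then e else x (suc (suc k))) (dec-true (suc (suc k) ℕ.≟ suc (suc k)) refl)

  y-old : ∀ j → j ≢ suc (suc k) → y j ≡ x j
  y-old j ne = cong (if_then e else x j) (dec-false (j ℕ.≟ suc (suc k)) ne)

  wrong′ : ∀ j → j < suc k → f (suc j) (y j) (y (suc (suc j))) ≢ y (suc j)
  wrong′ j j<1+k p with j ℕ.≟ k
  ... | yes refl = w (trans (cong₂ (f (suc k)) (trans (sym xₖ) (sym (y-old k λ ()))) (sym y-new))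
                     (trans p (trans (y-old (suc k) λ ()) xₖ₊₁)))
  ... | no j≢k = wrong j j<k (trans (cong₂ (f (suc j)) (sym (y-old j (ℕ.<⇒≢ (ℕ.m≤n⇒m≤1+n j<1+k))))
                                                       (sym (y-old (suc (suc j)) (λ { refl → j≢k refl }))))
                     (trans p (y-old (suc j) (ℕ.<⇒≢ (s≤s j<1+k)))))
    where
    j<k : j < k
    j<k = ℕ.≤∧≢⇒< (ℕ.≤-pred j<1+k) j≢k

-- Removing leaves

module Losing (G : Graph) where

  open Plans G hiding (local)
  open Bicyclic G
  open Cycles G

  -- The game on the subgraph induced by `S`, with placements still on all of `G`, so that no graph
  -- has to be rebuilt when a leaf is removed.
  record WinsOn (S : List V) : Set where
    field
      guess   : V → Placement G → Colour
      local   : ∀ v → v ∈ S → ∀ C C′ → (∀ u → u ∈ S → Adj G v u → C u ≡ C′ u) → guess v C ≡ guess v C′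
      winning : ∀ C → ∃ λ v → v ∈ S × guess v C ≡ C v

  wins⇒winsOn : ∀ {S} → (∀ v → v ∈ S) → SagesWin G → WinsOn S
  wins⇒winsOn all (s , win) = record
    { guess   = Strategy.guess s
    ; local   = λ v _ C C′ eq → Strategy.local s v C C′ λ u → eq u (all u)
    ; winning = λ C → let (v , p) = win C in v , all v , p
    }

  recolour : V → Colour → Placement G → Placement G
  recolour w c C u = if does (u ≟ w) then c else C u

  recolour-at : ∀ w c C → recolour w c C w ≡ c
  recolour-at w c C with w ≟ w
  ... | yes _ = refl
  ... | no ne = ⊥-elim (ne refl)

  recolour-off : ∀ {w u} c C → u ≢ w → recolour w c C u ≡ C u
  recolour-off {w} {u} c C ne with u ≟ w
  ... | yes p = ⊥-elim (ne p)
  ... | no _  = refl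

  -- Against a colour c of the leaf w, the colour x of the hub s must be caught by the guess of s
  -- or by leafGuess x ≡ c. Two colours x caught for every c would both equal the guess of s
  -- against a colour c avoiding their two leaf guesses, so s can guess the only such x.
  module Leaf {S w s} (w∉S : w ∉ S) (s∈S : s ∈ S) (ws : Adj G w s)
              (only : ∀ u → u ∈ S → Adj G w u → u ≡ s) (W : WinsOn (w ∷ S)) where

    open WinsOn W

    leafGuess : Colour → Colour
    leafGuess x = guess w λ _ → x

    Forced : Placement G → Colour → Set
    Forced C x = ∀ c → guess s (recolour w c C) ≡ x ⊎ leafGuess x ≡ c

    forced? : ∀ C → Dec (∃ (Forced C))
    forced? C = some? λ x → every? λ c → (guess s (recolour w c C) ≟ x) ⊎-dec (leafGuess x ≟ c)

    forced-unique : ∀ C {x y} → Forced C x → Forced C y → x ≡ y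
    forced-unique C {x} {y} p q with avoid (leafGuess x) (leafGuess y)
    ... | c , c≢x , c≢y with p c | q c
    ... | inj₁ r | inj₁ t = trans (sym r) t
    ... | inj₂ r | _      = ⊥-elim (c≢x (sym r))
    ... | inj₁ _ | inj₂ t = ⊥-elim (c≢y (sym t))

    hubGuess : Placement G → Colour
    hubGuess C with forced? C
    ... | yes (x , _) = x
    ... | no _        = 0F

    hubGuess-forced : ∀ C {x} → Forced C x → hubGuess C ≡ x
    hubGuess-forced C {x} p with forced? C
    ... | yes (y , q) = forced-unique C q p
    ... | no none     = ⊥-elim (none (x , p))

    guess′ : V → Placement G → Colour
    guess′ v C = if does (v ≟ s) then hubGuess C else guess v C

    guess′-hub : ∀ C → guess′ s C ≡ hubGuess C
    guess′-hub C with s ≟ s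
    ... | yes _ = refl
    ... | no ne = ⊥-elim (ne refl)

    guess′-other : ∀ {v} C → v ≢ s → guess′ v C ≡ guess v C
    guess′-other {v} C ne with v ≟ s
    ... | yes p = ⊥-elim (ne p)
    ... | no _  = refl

    leaf-right : ∀ C → guess w C ≡ leafGuess (C s)
    leaf-right C = local w (here refl) C (λ _ → C s) λ
      { u (here refl) a → ⊥-elim (Adj-irrefl a)
      ; u (there u∈) a → cong C (only u u∈ a) }

    local′ : ∀ v → v ∈ S → ∀ C C′ → (∀ u → u ∈ S → Adj G v u → C u ≡ C′ u) → guess′ v C ≡ guess′ v C′
    local′ v v∈ C C′ eq with v ≟ s
    ... | no v≢s = local v (there v∈) C C′ λ
      { u (here refl) a → ⊥-elim (v≢s (only v v∈ (Adj-sym a)))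
      ; u (there u∈) a → eq u u∈ a }
    ... | yes refl = hub-local
      where
      same : ∀ c → guess s (recolour w c C) ≡ guess s (recolour w c C′)
      same c = local s (there s∈S) _ _ λ
        { u (here refl) a → trans (recolour-at w c C) (sym (recolour-at w c C′))
        ; u (there u∈) a → let u≢w = λ { refl → w∉S u∈ } in
            trans (recolour-off c C u≢w) (trans (eq u u∈ a) (sym (recolour-off c C′ u≢w))) }

      transfer : ∀ {x} → Forced C x → Forced C′ x
      transfer p c = [ (λ q → inj₁ (trans (sym (same c)) q)) , inj₂ ]′ (p c)

      transfer⁻ : ∀ {x} → Forced C′ x → Forced C x
      transfer⁻ p c = [ (λ q → inj₁ (trans (same c) q)) , inj₂ ]′ (p c)

      hub-local : hubGuess C ≡ hubGuess C′
      hub-local with forced? C | forced? C′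
      ... | yes (x , p) | yes (y , q) = forced-unique C p (transfer⁻ q)
      ... | yes (x , p) | no none     = ⊥-elim (none (x , transfer p))
      ... | no none     | yes (y , q) = ⊥-elim (none (y , transfer⁻ q))
      ... | no _        | no _        = refl

    winning′ : ∀ C → ∃ λ v → v ∈ S × guess′ v C ≡ C v
    winning′ C with Any.any? (λ v → guess′ v C ≟ C v) S
    ... | yes some = find some
    ... | no none  = s , s∈S , trans (guess′-hub C) (hubGuess-forced C forced)
      where
      forced : Forced C (C s)
      forced c with winning (recolour w c C)
      ... | v , here refl , p = inj₂ (trans (sym (trans (leaf-right (recolour w c C))
        (cong leafGuess (recolour-off c C λ { refl → w∉S s∈S })))) (trans p (recolour-at w c C)))
      ... | v , there v∈ , p with v ≟ s
      ...   | yes refl = inj₁ (trans p (recolour-off c C λ { refl → w∉S s∈S }))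
      ...   | no v≢s   = ⊥-elim (none (lose v∈ (trans (guess′-other C v≢s)
        (trans (local v (there v∈) C (recolour w c C) λ
          { u (here refl) a → ⊥-elim (v≢s (only v v∈ (Adj-sym a)))
          ; u (there u∈) a → sym (recolour-off c C λ { refl → w∉S u∈ }) })
        (trans p (recolour-off c C λ { refl → w∉S v∈ }))))))

    winsOn : WinsOn S
    winsOn = record { guess = guess′ ; local = local′ ; winning = winning′ }

  Linked : List V → Set
  Linked S = ∀ {u v} → u ∈ S → v ∈ S → u ≡ v ⊎ ∃ λ ps → Chain u ps v × All (_∈ S) ps

  crossing-edge : ∀ {S u v} → Walk G u v → u ∉ S → v ∈ S → ∃₂ λ w s → w ∉ S × s ∈ S × Adj G w s
  crossing-edge here u∉ v∈ = ⊥-elim (u∉ v∈)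
  crossing-edge {S} {u} (step {v = w} a ω) u∉ v∈ with w ∈? S
  ... | yes w∈ = u , w , u∉ , w∈ , a
  ... | no w∉  = crossing-edge ω w∉ v∈

  linked-∷ : ∀ {S w s} → Linked S → s ∈ S → Adj G w s → Linked (w ∷ S)
  linked-∷ {S} {w} {s} link s∈ ws = go
    where
    from-w : ∀ {v} → v ∈ S → ∃ λ ps → Chain w ps v × All (_∈ w ∷ S) ps
    from-w v∈ with link s∈ v∈
    ... | inj₁ refl           = [] , ws , []
    ... | inj₂ (ps , c , all) = s ∷ ps , (ws , c) , All.map there (s∈ ∷ all)

    go : Linked (w ∷ S)
    go (here refl) (here refl) = inj₁ refl
    go (here refl) (there v∈)  = inj₂ (from-w v∈)
    go (there u∈)  (here refl) = let (ps , c , all) = from-w u∈ in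
      inj₂ (reverse ps , chain-reverse ps c , ↭.All-resp-↭ (↭-sym (↭.↭-reverse ps)) all)
    go (there u∈)  (there v∈) with link u∈ v∈
    ... | inj₁ eq             = inj₁ eq
    ... | inj₂ (ps , c , all) = inj₂ (ps , c , All.map there all)

  -- The cycle is based at `w` because `peel` controls only the base vertex of each cycle.
  second-neighbour : ∀ {S w s t} → Linked S → w ∉ S → s ∈ S → t ∈ S → s ≢ t → Adj G w s → Adj G w t →
    ∃ λ (c : Cycle G) → vs c zero ≡ w
  second-neighbour {S} {w} {s} {t} link w∉ s∈ t∈ s≢t ws wt with link s∈ t∈
  ... | inj₁ eq = ⊥-elim (s≢t eq)
  ... | inj₂ (ps , c , all) with erase ps s≢t c
  ... | ps′ , c′ , un , sub = ring-cycle r , refl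
    where
    in-S : All (_∈ S) (s ∷ ps′ ++ [ t ])
    in-S = s∈ ∷ All.++⁺ (sub all) (t∈ ∷ [])

    r : Ring w (s ∷ ps′ ++ [ t ])
    r = ring (ws , chain-++ ps′ [] c′ (Adj-sym wt)) (All.map (λ { v∈ refl → w∉ v∈ }) in-S ∷ un)
      (s≤s (ℕ.≤-trans (s≤s z≤n) (ℕ.≤-reflexive (↭.↭-length (↭.++-comm [ t ] ps′)))))

  -- Peel off, one leaf at a time, the vertices outside S; they are leaves in reverse order of
  -- attachment because a second neighbour would close a cycle through a vertex outside S.
  peel : Connected G → ∀ k R S → length R ≤ k → (∀ v → v ∈ S ⊎ v ∈ R) → (∃ λ s → s ∈ S) → Linked S →
    (∀ (c : Cycle G) → vs c zero ∈ S) → SagesWin G → WinsOn S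
  peel conn k R S R≤k cover (s₀ , s₀∈) link cyc win with all? (_∈? S)
  ... | yes all = wins⇒winsOn all win
  ... | no ¬all with ¬∀⟶∃¬ _ (_∈ S) (_∈? S) ¬all
  ... | v₀ , v₀∉ with crossing-edge (conn v₀ s₀) v₀∉ s₀∈
  ... | w , s , w∉ , s∈ , ws with cover w
  ...   | inj₁ w∈ = ⊥-elim (w∉ w∈)
  ...   | inj₂ w∈R with ∈-∃++ w∈R
  peel conn zero R S R≤k cover (s₀ , s₀∈) link cyc win | no _ | _ | _ | _ | [] , bs , refl = case R≤k of λ ()
  peel conn zero R S R≤k cover (s₀ , s₀∈) link cyc win | no _ | _ | _ | _ | _ ∷ as , bs , refl = case R≤k of λ ()
  peel conn (suc k) R S R≤k cover (s₀ , s₀∈) link cyc win | no _ | _ | w , s , w∉ , s∈ , ws | inj₂ w∈R | as , bs , refl =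
    Leaf.winsOn w∉ s∈ ws only
      (peel conn k (as ++ bs) (w ∷ S) smaller cover′ (w , here refl) (linked-∷ link s∈ ws) (λ c → there (cyc c)) win)
    where
    smaller : length (as ++ bs) ≤ k
    smaller = ℕ.≤-pred (ℕ.≤-trans (ℕ.≤-reflexive (sym (↭.↭-length (↭.shift w as bs)))) R≤k)

    cover′ : ∀ v → v ∈ w ∷ S ⊎ v ∈ as ++ bs
    cover′ v with cover v
    ... | inj₁ v∈ = inj₁ (there v∈)
    ... | inj₂ v∈ with ↭.∈-resp-↭ (↭.shift w as bs) v∈
    ...   | here eq  = inj₁ (here eq)
    ...   | there v∈ = inj₂ v∈

    only : ∀ u → u ∈ S → Adj G w u → u ≡ s
    only u u∈ wu with u ≟ s
    ... | yes eq = eq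
    ... | no u≢s = let (c , eq) = second-neighbour link w∉ s∈ u∈ (u≢s ∘ sym) ws wu in
      ⊥-elim (w∉ (subst (_∈ S) eq (cyc c)))

  tree-loses : IsTree G → SagesLose G
  -- The graph may have no vertices; the assumed winning strategy provides one.
  tree-loses (conn , acyclic) win@(_ , wins) = go (proj₁ (wins λ _ → 0F))
    where
    go : V → ⊥
    go v = proj₁ (proj₂ (avoid (g 0F) (g 0F))) (trans (sym right) (eq c))
      where
      W : WinsOn [ v ]
      W = peel conn (length (allFin (Graph.n G))) (allFin (Graph.n G)) [ v ] ℕ.≤-refl (λ u → inj₂ (∈-allFin u)) (v , here refl)
        (λ { (here refl) (here refl) → inj₁ refl }) (λ c → ⊥-elim (acyclic c)) win
      open WinsOn W
      g : Colour → Colour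
      g c = guess v λ _ → c
      eq : ∀ c → g c ≡ g 0F
      eq c = local v (here refl) _ _ λ { u (here refl) a → ⊥-elim (Adj-irrefl a) }
      c : Colour
      c = proj₁ (avoid (g 0F) (g 0F))
      right : g c ≡ c
      right = case winning (λ _ → c) of λ { (_ , here refl , p) → p }

  -- The game on the remaining cycle

  ring-linked : ∀ {z ps} → Ring z ps → Linked (z ∷ ps)
  ring-linked r u∈ v∈ with rotate-ring r u∈
  ... | qs , r′ , turn with ↭.∈-resp-↭ turn v∈
  ... | here refl = inj₁ refl
  ... | there v∈qs with ∈-∃++ v∈qs
  ... | as , bs , refl = inj₂ (as , proj₁ (chain-++⁻ as bs (chain r′)) ,
    All.tabulate λ i → ↭.∈-resp-↭ (↭-sym turn) (there (∈-++⁺ˡ i)))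

  module Unicyclic (c : Cycle G) (same : ∀ c′ → SameCycle c c′) (W : WinsOn (vertices c)) where

    open WinsOn W

    k : ℕ
    k = m c

    v : ℕ → V
    v j = vs c (position j)

    v-periodic : ∀ j → v (j + suc k) ≡ v j
    v-periodic j = cong (vs c) (position-periodic k j)

    -- The predecessor of v i is v (i + k).
    rule : V → V → Rule
    rule p q a b = guess p λ u → if does (u ≟ q) then a else b

    f : ℕ → Rule
    f i = rule (v i) (v (i + k))

    edge⇒next : ∀ {a u} → CycleEdge c a u →
      ∃ λ i → (a ≡ vs c i × u ≡ vs c (next i)) ⊎ (u ≡ vs c i × a ≡ vs c (next i))
    edge⇒next (inj₁ (i , inj₁ (refl , refl))) = inject₁ i , inj₁ (refl , cong (vs c) (sym (next-inject₁ i)))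
    edge⇒next (inj₁ (i , inj₂ (refl , refl))) = inject₁ i , inj₂ (refl , cong (vs c) (sym (next-inject₁ i)))
    edge⇒next (inj₂ (inj₁ (refl , refl)))     = fromℕ k , inj₁ (refl , cong (vs c) (sym (next-fromℕ k)))
    edge⇒next (inj₂ (inj₂ (refl , refl)))     = fromℕ k , inj₂ (refl , cong (vs c) (sym (next-fromℕ k)))

    chordless : ∀ {a u} → a ∈ vertices c → u ∈ vertices c → Adj G a u → CycleEdge c a u
    chordless {a} {u} a∈ u∈ au with CycleEdge? c a u
    ... | yes e = e
    ... | no ¬e = ⊥-elim ([ (λ ch → ¬e (CycleEdge-sym c (short au ch))) , (λ ch → ¬e (short (Adj-sym au) ch)) ]′
      (chords c (λ { refl → Adj-irrefl au }) a∈ u∈ ¬e))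
      where
      short : ∀ {a u} → Adj G a u → Chord c a u → CycleEdge c u a
      short au ch = let (c′ , e) = chord-cycle c au ch in Equivalence.from (same c′ _ _) e

    neighbours : ∀ j u → u ∈ vertices c → Adj G (v (suc j)) u → u ≡ v j ⊎ u ≡ v (suc (suc j))
    neighbours j u u∈ a with edge⇒next (chordless (∈-tabulate⁺ {f = vs c} (position (suc j))) u∈ a)
    ... | i , inj₁ (p , refl) = inj₂ (cong (vs c ∘ next) (sym (inj c p)))
    ... | i , inj₂ (refl , p) = inj₁ (cong (vs c) (sym (next-injective (position j) i (inj c p))))

    placement : (ℕ → Colour) → Placement G
    placement x u with any? (λ i → vs c i ≟ u)
    ... | yes (i , _) = x (toℕ i)
    ... | no _        = 0F

    placement-at : ∀ x i → placement x (vs c i) ≡ x (toℕ i)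
    placement-at x i with any? (λ i′ → vs c i′ ≟ vs c i)
    ... | yes (i′ , p) = cong (x ∘ toℕ) (inj c p)
    ... | no none      = ⊥-elim (none (i , refl))

    -- The inner positions of a run are 1 to n, so vertex 0 is met as position n.
    visited : ∀ {u} → u ∈ vertices c → ∃ λ j → j < suc k × v (suc j) ≡ u
    visited u∈ with ∈-tabulate⁻ {f = vs c} u∈
    ... | zero  , refl = k , ℕ.≤-refl , cong (vs c) (position-suc k)
    ... | suc i , refl = toℕ i , ℕ.m≤n⇒m≤1+n (Fin.toℕ<n i) , cong (vs c) (position-toℕ (suc (toℕ i)) (suc i) refl)

    no-closed-run : ∀ a b → ¬ Run f (suc k) a b a b
    no-closed-run a b r with run-colours r
    ... | x , (x₀ , x₁) , (xₙ , xₙ₊₁) , wrong with winning (placement x)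
    ... | u , u∈ , right with visited u∈
    ... | j , j<n , refl = wrong j j<n (trans (sym guess≡) (trans right (C-v (suc j) (ℕ.m≤n⇒m≤1+n j<n))))
      where
      C : Placement G
      C = placement x

      -- Positions n and n + 1 wrap round to 0 and 1, and there the run has to be closed.
      C-v : ∀ i → i ≤ suc (suc k) → C (v i) ≡ x i
      C-v i i≤ with i ℕ.≤? k
      ... | yes i≤k = trans (placement-at x (position i)) (cong x (toℕ-position k i i≤k))
      ... | no i≰k with i ℕ.≟ suc k
      ...   | yes refl = trans (cong C (cong (vs c) (position-suc k))) (trans (placement-at x zero) (trans x₀ (sym xₙ)))
      ...   | no i≢ with ℕ.≤-antisym i≤ (ℕ.≤∧≢⇒< (ℕ.≰⇒> i≰k) (i≢ ∘ sym))
      ...     | refl = trans (cong C (v-periodic 1)) (trans (placement-at x (position 1))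
                 (trans (cong x (toℕ-position k 1 (ℕ.≤-trans (s≤s z≤n) (m≥2 c)))) (trans x₁ (sym xₙ₊₁))))

      pred : v (suc j + k) ≡ v j
      pred = trans (cong v (sym (ℕ.+-suc j k))) (v-periodic j)

      guess≡ : guess (v (suc j)) C ≡ f (suc j) (x j) (x (suc (suc j)))
      guess≡ = local (v (suc j)) (∈-tabulate⁺ {f = vs c} (position (suc j))) _ _ seen
        where
        seen : ∀ u → u ∈ vertices c → Adj G (v (suc j)) u →
               C u ≡ (if does (u ≟ v (suc j + k)) then x j else x (suc (suc j)))
        seen u u∈ a with u ≟ v (suc j + k)
        ... | yes refl = trans (cong C pred) (C-v j (ℕ.m≤n⇒m≤1+n (ℕ.<⇒≤ j<n)))
        ... | no ne with neighbours j u u∈ a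
        ...   | inj₁ eq   = ⊥-elim (ne (trans eq (sym pred)))
        ...   | inj₂ refl = C-v (suc (suc j)) (s≤s j<n)

    winner : Winner (suc k) f
    winner = record
      { periodic = λ j → cong₂ rule (v-periodic j) (trans (cong v (comm j)) (v-periodic (j + k)))
      ; unbeaten = no-closed-run
      }
      where
      comm : ∀ j → (j + suc k) + k ≡ (j + k) + suc k
      comm j = trans (ℕ.+-assoc j (suc k) k) (trans (cong (j +_) (ℕ.+-comm (suc k) k)) (sym (ℕ.+-assoc j k (suc k))))

  unicyclic-loses : Connected G → UniqueCycleGood G → SagesLose G
  unicyclic-loses conn (c , same , 5≤len , 3∤len) win =
    no-winner {m c ∸ 4} (3∤len ∘ subst (3 ∣_) len≡)
      (subst (λ k → Winner k (Unicyclic.f c same W)) (sym len≡) (Unicyclic.winner c same W))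
    where
    len≡ : 5 + (m c ∸ 4) ≡ len c
    len≡ = ℕ.m+[n∸m]≡n 5≤len

    W : WinsOn (vertices c)
    W = peel conn (length (allFin (Graph.n G))) (allFin (Graph.n G)) (vertices c) ℕ.≤-refl (λ u → inj₂ (∈-allFin u))
      (vs c zero , here refl) (ring-linked (cycle-ring c))
      (λ c′ → CycleEdge⇒∈ c (Equivalence.from (same c′ (vs c′ zero) (vs c′ (fromℕ (m c′)))) (inj₂ (inj₂ (refl , refl))))) win

theorem20 : (G : Graph) → Connected G → (SagesLose G ⇔ (IsTree G ⊎ UniqueCycleGood G))
theorem20 G conn = mk⇔ to from
  where
  open Cycles G
  open Losing G

  to : SagesLose G → IsTree G ⊎ UniqueCycleGood G
  to lose with cycle?
  ... | no acyclic = inj₁ (conn , acyclic)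
  ... | yes c = inj₂ (c , same , at-least-5 , λ 3∣ → lose (cycle-wins c (inj₁ 3∣)))
    where
    transfer : ∀ (c c′ : Cycle G) {u v} → CycleEdge c′ u v → CycleEdge c u v
    transfer c c′ {u} {v} e with CycleEdge? c u v
    ... | yes e′ = e′
    ... | no ¬e  = ⊥-elim (lose (two-cycles-win conn c c′ e ¬e))

    same : ∀ c′ → SameCycle c c′
    same c′ u v = mk⇔ (transfer c′ c) (transfer c c′)

    at-least-5 : 5 ≤ len c
    at-least-5 with len c ℕ.≟ 3 | len c ℕ.≟ 4
    ... | yes p | _     = ⊥-elim (lose (cycle-wins c (inj₁ (divides 1 p))))
    ... | no _  | yes p = ⊥-elim (lose (cycle-wins c (inj₂ p)))
    ... | no p  | no q  = ℕ.≤∧≢⇒< (ℕ.≤∧≢⇒< (s≤s (m≥2 c)) (p ∘ sym)) (q ∘ sym)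

  from : IsTree G ⊎ UniqueCycleGood G → SagesLose G
  from = [ tree-loses , unicyclic-loses conn ]′
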